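{- Let $\mathbf{w}\in\{0,1,2\}^\omega$ be an infinite word with factor complexity $2n+1$, i.e. for every $n\ge 0$ the number of distinct factors of $\mathbf{w}$ of length $n$ is exactly $2n+1$. Then the critical exponent of $\mathbf{w}$ is at least $\mu=2+\frac{1}{\lambda^2-1}=2.4808726\cdots$, where $\lambda\approx 1.7548777$ is the real zero of $x^3-2x^2+x-1$.
   Context: For a finite nonempty word $x$ with smallest period $p$, its exponent is $|x|/p$. The critical exponent of an infinite word is the supremum of the exponents of its finite nonempty factors. (The number $\mu$ is the critical exponent of the fixed point $\gamma^\omega(0)$ of the morphism $\gamma:0\mapsto 01,\ 1\mapsto 2,\ 2\mapsto 02$.) -}

module Defs where

open import Data.Nat as ℕ using (ℕ; zero; suc; _≤_)
open import Data.Integer using (+_)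
open import Data.Fin using (Fin; toℕ)
open import Data.Vec using (Vec; tabulate)
open import Data.List using (List; length)
open import Data.List.Membership.Propositional using (_∈_)
open import Data.List.Relation.Unary.Unique.Propositional using (Unique)
open import Data.Product using (Σ; ∃; _×_; _,_)
open import Data.Sum using (_⊎_)
open import Function.Bundles using (_⇔_)
open import Relation.Binary.PropositionalEquality using (_≡_)
open import Data.Rational as ℚ using (ℚ; _/_; 0ℚ; 1ℚ)

Word : Set
Word = ℕ → Fin 3

factorAt : Word → ℕ → (n : ℕ) → Vec (Fin 3) n
factorAt w i n = tabulate (λ j → w (i ℕ.+ toℕ j))

IsFactor : Word → (n : ℕ) → Vec (Fin 3) n → Set
IsFactor w n u = ∃ λ i → factorAt w i n ≡ u

HasNFactors : Word → ℕ → ℕ → Set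
HasNFactors w n k =
  Σ (List (Vec (Fin 3) n)) λ L →
    Unique L × length L ≡ k × (∀ u → (u ∈ L) ⇔ IsFactor w n u)

ComplexityTwoNPlusOne : Word → Set
ComplexityTwoNPlusOne w = ∀ n → HasNFactors w n (suc (2 ℕ.* n))

IsPeriod : Word → ℕ → ℕ → ℕ → Set
IsPeriod w i m p = 1 ≤ p × (∀ j → j ℕ.+ p ℕ.< m → w (i ℕ.+ j) ≡ w (i ℕ.+ j ℕ.+ p))

IsSmallestPeriod : Word → ℕ → ℕ → ℕ → Set
IsSmallestPeriod w i m p = IsPeriod w i m p × (∀ p' → IsPeriod w i m p' → p ≤ p')

ℕtoℚ : ℕ → ℚ
ℕtoℚ n = (+ n) / 1

HasFactorWithExponentAbove : Word → ℚ → Set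
HasFactorWithExponentAbove w q =
  ∃ λ i → ∃ λ m → ∃ λ p → 1 ≤ m × IsSmallestPeriod w i m p × (q ℚ.* ℕtoℚ p) ℚ.< ℕtoℚ m

fλ : ℚ → ℚ
fλ x = x ℚ.* x ℚ.* x ℚ.- ℕtoℚ 2 ℚ.* x ℚ.* x ℚ.+ x ℚ.- 1ℚ

-- λ < c  (for rational c), where λ is the unique real zero of f; since f < 0 on (-∞,λ)
-- and f > 0 on (λ,∞), this is f(c) > 0.
λBelow : ℚ → Set
λBelow c = 0ℚ ℚ.< fλ c

-- q < μ = 2 + 1/(λ²-1)  (Dedekind lower cut of μ):
-- either q ≤ 2, or q > 2 and λ² - 1 < 1/(q-2), i.e. there is a rational c > λ, c ≥ 0,
-- with (c² - 1)(q - 2) < 1.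
BelowMu : ℚ → Set
BelowMu q = (q ℚ.≤ ℕtoℚ 2) ⊎
  (ℕtoℚ 2 ℚ.< q × ∃ λ c → 0ℚ ℚ.≤ c × λBelow c × ((c ℚ.* c ℚ.- 1ℚ) ℚ.* (q ℚ.- ℕtoℚ 2)) ℚ.< 1ℚ)

CriticalExponentAtLeastMu : Word → Set
CriticalExponentAtLeastMu w = ∀ q → BelowMu q → HasFactorWithExponentAbove w q

{-# OPTIONS --safe #-}
-- Suppose that no factor of length at most N has exponent above q. The words that occur infinitely
-- often in w form a language that is closed under factors, extendable on both sides, has at most
-- 2n + 1 words of each length n and avoids exponents ≥ 5/2 > q. Deciding one short word after the
-- other, every branch dies or ends in a language all of whose words are coded by the three first
-- returns to some letter f, where the coding language R′ avoids seven short words, all absent from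
-- the fixed point of h : 0 ↦ 01, 1 ↦ 21, 2 ↦ 0. Such an R′ is itself coded by the first returns
-- 0121, 021, 01 to the letter 0, which are the images under h², and the new coding language again
-- avoids the seven words, because each of them would force a repetition of exponent ≥ 5/2 whatever
-- the lengths of the words that the letters stand for. Decoding k times produces a repetition
-- 𝔸 k ++ 𝕋 k with |𝕋 k| = |𝔸 1| + ⋯ + |𝔸 k|. As |𝔸 k| grows like λ²ᵏ, its exponent
-- 1 + |𝕋 k| / |𝔸 k| tends to 1 + 1 / (1 - λ⁻²) = μ.
module Submission where

open import Defs
open import Data.Bool using (Bool; true; false; _∧_; _∨_; if_then_else_)
open import Data.Bool.ListAction using (all; any)
open import Data.Empty using (⊥; ⊥-elim)
open import Data.Fin as Fin using (Fin; toℕ; fromℕ<)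
open import Data.Fin.Properties using (toℕ-fromℕ<)
import Data.Integer as ℤ
import Data.Integer.Properties as ℤ
open import Data.List using (List; []; _∷_; _++_; map; reverse; length; take; drop; tails; _∷ʳ_)
open import Data.List.Membership.Propositional using (_∈_; mapWith∈; find)
open import Data.List.Membership.Propositional.Properties using (∈-map⁺; ∈-map⁻; ∈-∃++; ∈-++⁻; ∈-++⁺ˡ; ∈-++⁺ʳ)
open import Data.List.Properties using (++-assoc; ++-identityʳ; ∷-injective; length-++; length-map; length-reverse; length-take; map-++; reverse-++; reverse-involutive; take++drop≡id; unfold-reverse)
open import Data.List.Relation.Unary.All as All using (All; []; _∷_)
open import Data.List.Relation.Unary.All.Properties using (map⁺)
open import Data.List.Relation.Unary.AllPairs using ([]; _∷_)
open import Data.List.Relation.Unary.Any using (here; there; any?)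
open import Data.List.Relation.Unary.Any.Properties using (mapWith∈⁺)
open import Data.List.Relation.Unary.Unique.Propositional using (Unique)
import Data.List.Relation.Unary.Unique.Propositional.Properties as Unique
open import Data.Nat using (ℕ; zero; suc; _+_; _*_; _∸_; _^_; _⊔_; _/_; _%_; _≤_; _<_; _≤ᵇ_; _<ᵇ_; _≤?_; _<?_; _≟_; z≤n; s≤s; >-nonZero)
open import Data.Nat.Properties hiding (_≤?_; _<?_; _≟_)
open import Data.Nat.Tactic.RingSolver using (solve-∀)
open import Data.Product using (∃; _×_; _,_; proj₁; proj₂)
open import Data.Rational as ℚ using (ℚ; mkℚ; 0ℚ; 1ℚ; toℚᵘ; *≤*)
import Data.Rational.Properties as ℚ
open import Data.Rational.Solver using (module +-*-Solver)
open import Data.Rational.Unnormalised as ℚᵘ using (ℚᵘ; mkℚᵘ; _≃_; *≡*; *<*)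
import Data.Rational.Unnormalised.Properties as ℚᵘ
open import Data.Sum using (_⊎_; inj₁; inj₂; [_,_]′)
open import Data.Unit using (⊤; tt)
open import Data.Vec using (Vec; toList; lookup)
open import Data.Vec.Properties using (lookup∘tabulate; tabulate-cong)
open import Function using (_∘_; Equivalence)
open import Relation.Nullary using (¬_; Dec; yes; no)
open import Relation.Nullary.Decidable using (decidable-stable; map′; _×-dec_; _→-dec_)
open import Relation.Unary using (Decidable)
open import Relation.Binary.PropositionalEquality using (_≡_; _≢_; refl; sym; trans; cong; cong₂; subst; subst₂; module ≡-Reasoning)

-- Whether a word recurs in `w` cannot be decided, so `nonempty`, `left` and `right` in `Language`
-- are doubly negated and the whole case analysis ends in `⊥`. A repetition is recovered from it
-- because the complexity hypothesis lists the factors of each length together with positions: the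
-- existence of a repetition of length at most `N` is decidable. Hence `N` has to be fixed before
-- any language is known. This is why the blocks at the leaves are short, why bounds on the weights
-- are carried along, and why the number of decodings may depend only on the numerical data and
-- three block lengths. Recurrent words replace factors because a factor that occurs only at the
-- start of `w` has no extension to the left. The price is that words may get lost: only the upper
-- bound 2n + 1 survives, and even binary languages have to be excluded. The searches never see q.
-- Testing against the fixed threshold 5/2 lets `refl` evaluate them once for all q.

∧-true : ∀ {x y} → x ∧ y ≡ true → x ≡ true × y ≡ true
∧-true {true} {true} refl = refl , refl

∨-true : ∀ {x y} → x ∨ y ≡ true → x ≡ true ⊎ y ≡ true
∨-true {true} _ = inj₁ refl
∨-true {false} y≡true = inj₂ y≡true

any-true : ∀ {X : Set} (p : X → Bool) xs → any p xs ≡ true → ∃ λ x → x ∈ xs × p x ≡ true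
any-true p (x ∷ xs) eq with ∨-true {p x} eq
... | inj₁ px = x , here refl , px
... | inj₂ rest with any-true p xs rest
... | y , y∈xs , py = y , there y∈xs , py

all-true : ∀ {X : Set} (p : X → Bool) xs → all p xs ≡ true → All (λ x → p x ≡ true) xs
all-true p [] _ = []
all-true p (x ∷ xs) eq with ∧-true {p x} eq
... | px , rest = px ∷ all-true p xs rest

-- Finite words, their Boolean tests and their weights

data Letter : Set where
  𝟎 𝟏 𝟐 : Letter

FinWord : Set
FinWord = List Letter

_==_ : Letter → Letter → Bool
𝟎 == 𝟎 = true
𝟏 == 𝟏 = true
𝟐 == 𝟐 = true
_ == _ = false

==⇒≡ : ∀ {x y} → (x == y) ≡ true → x ≡ y
==⇒≡ {𝟎} {𝟎} _ = refl
==⇒≡ {𝟏} {𝟏} _ = refl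
==⇒≡ {𝟐} {𝟐} _ = refl

_==ʷ_ : FinWord → FinWord → Bool
[] ==ʷ [] = true
(x ∷ u) ==ʷ (y ∷ v) = (x == y) ∧ (u ==ʷ v)
_ ==ʷ _ = false

==ʷ⇒≡ : ∀ {u v} → (u ==ʷ v) ≡ true → u ≡ v
==ʷ⇒≡ {[]} {[]} _ = refl
==ʷ⇒≡ {x ∷ u} {y ∷ v} eq with ∧-true {x == y} eq
... | x≡y , u≡v = cong₂ _∷_ (==⇒≡ x≡y) (==ʷ⇒≡ u≡v)

isPrefix : FinWord → FinWord → Bool
isPrefix [] _ = true
isPrefix (_ ∷ _) [] = false
isPrefix (x ∷ u) (y ∷ v) = (x == y) ∧ isPrefix u v

isPrefix-sound : ∀ u v → isPrefix u v ≡ true → ∃ λ w → v ≡ u ++ w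
isPrefix-sound [] v _ = v , refl
isPrefix-sound (x ∷ u) (y ∷ v) eq with ∧-true {x == y} eq
... | x≡y , rest with isPrefix-sound u v rest
... | w , refl = w , cong (_∷ _) (sym (==⇒≡ x≡y))

isInfix : FinWord → FinWord → Bool
isInfix u v = any (isPrefix u) (tails v)

isInfix-sound : ∀ u v → isInfix u v ≡ true → ∃ λ w → ∃ λ z → v ≡ w ++ u ++ z
isInfix-sound u [] eq with ∨-true {isPrefix u []} eq
... | inj₁ p = [] , isPrefix-sound u [] p
isInfix-sound u v@(x ∷ v′) eq with ∨-true {isPrefix u v} eq
... | inj₁ p = [] , isPrefix-sound u v p
... | inj₂ p with isInfix-sound u v′ p
... | w , z , v′≡ = x ∷ w , z , cong (x ∷_) v′≡

-- The cut-off at `n` keeps the repetitions that are detected below the length bound contained in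
-- `Bad`.
lcp : ℕ → FinWord → FinWord → FinWord
lcp zero _ _ = []
lcp (suc n) (x ∷ u) (y ∷ v) = if x == y then x ∷ lcp n u v else []
lcp (suc n) _ _ = []

lcp-prefixˡ : ∀ n u v → ∃ λ w → u ≡ lcp n u v ++ w
lcp-prefixˡ zero u v = u , refl
lcp-prefixˡ (suc n) [] v = [] , refl
lcp-prefixˡ (suc n) u@(_ ∷ _) [] = u , refl
lcp-prefixˡ (suc n) (x ∷ u) (y ∷ v) with x == y | lcp-prefixˡ n u v
... | true | w , u≡ = w , cong (x ∷_) u≡
... | false | _ = x ∷ u , refl

lcp-prefixʳ : ∀ n u v → ∃ λ w → v ≡ lcp n u v ++ w
lcp-prefixʳ zero u v = v , refl
lcp-prefixʳ (suc n) [] v = v , refl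
lcp-prefixʳ (suc n) (_ ∷ _) [] = [] , refl
lcp-prefixʳ (suc n) (x ∷ u) (y ∷ v) with x == y in eq | lcp-prefixʳ n u v
... | true | w , v≡ = w , cong₂ _∷_ (sym (==⇒≡ eq)) v≡
... | false | _ = y ∷ v , refl

length-lcp : ∀ n u v → length (lcp n u v) ≤ n
length-lcp zero u v = z≤n
length-lcp (suc n) [] v = z≤n
length-lcp (suc n) (_ ∷ _) [] = z≤n
length-lcp (suc n) (x ∷ u) (y ∷ v) with x == y
... | true = s≤s (length-lcp n u v)
... | false = z≤n

prefix-of-prefix : ∀ (u v : FinWord) {w z} → u ++ w ≡ v ++ z → length u ≤ length v → ∃ λ x → v ≡ u ++ x
prefix-of-prefix [] v _ _ = v , refl
prefix-of-prefix (x ∷ u) (y ∷ v) eq (s≤s le) with ∷-injective eq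
... | refl , eq′ with prefix-of-prefix u v eq′ le
... | z , v≡ = z , cong (x ∷_) v≡

Weight : Set
Weight = Letter → ℕ

wt : Weight → FinWord → ℕ
wt ω [] = 0
wt ω (x ∷ u) = ω x + wt ω u

wt-++ : ∀ ω u v → wt ω (u ++ v) ≡ wt ω u + wt ω v
wt-++ ω [] v = refl
wt-++ ω (x ∷ u) v = trans (cong (ω x +_) (wt-++ ω u v)) (sym (+-assoc (ω x) _ _))

wt-reverse : ∀ ω u → wt ω (reverse u) ≡ wt ω u
wt-reverse ω [] = refl
wt-reverse ω (x ∷ u) = begin
  wt ω (reverse (x ∷ u))       ≡⟨ cong (wt ω) (unfold-reverse x u) ⟩
  wt ω (reverse u ∷ʳ x)        ≡⟨ wt-++ ω (reverse u) _ ⟩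
  wt ω (reverse u) + (ω x + 0) ≡⟨ cong₂ _+_ (wt-reverse ω u) (+-identityʳ (ω x)) ⟩
  wt ω u + ω x                 ≡⟨ +-comm (wt ω u) (ω x) ⟩
  wt ω (x ∷ u)                 ∎
  where open ≡-Reasoning

-- Languages that avoid repetitions

-- A word A ++ T with A ++ T ≡ T ++ Z has period |A|; Bad p t says that the repetitions with
-- |A| = p and |T| = t are to be avoided.

module Avoiding (Bad : ℕ → ℕ → Set) where

  -- Repetitions are measured by `ω`, not by length, so that a language and all languages decoded
  -- from it speak of the same lengths in `w`.
  record Language (ω : Weight) (R : FinWord → Set) : Set where
    field
      nonempty : ¬ ¬ R []
      factor   : ∀ u {v} w → R (u ++ v ++ w) → R v
      left     : ∀ u → R u → ¬ ¬ ∃ λ x → R (x ∷ u)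
      right    : ∀ u → R u → ¬ ¬ ∃ λ x → R (u ∷ʳ x)
      light    : ∀ A T Z → A ++ T ≡ T ++ Z → Bad (wt ω A) (wt ω T) → ¬ R (A ++ T)

    prefix : ∀ {v} w → R (v ++ w) → R v
    prefix w = factor [] w

    suffix : ∀ u {v} → R (u ++ v) → R v
    suffix u {v} r = factor u [] (subst (λ z → R (u ++ z)) (sym (++-identityʳ v)) r)

  -- Backwards, `reverse Z` takes the place of `A`. It weighs the same, since `A` and `Z` both
  -- complement `T` in one word.
  reverse-language : ∀ {ω R} → Language ω R → Language ω (R ∘ reverse)
  reverse-language {ω} {R} L = record
    { nonempty = nonempty
    ; factor = λ u {v} w r → factor (reverse w) (reverse u) (subst R (rev₃ u v w) r)
    ; left = λ u r k → right (reverse u) r λ { (x , r′) → k (x , subst R (sym (unfold-reverse x u)) r′) }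
    ; right = λ u r k → left (reverse u) r λ { (x , r′) → k (x , subst R (sym (reverse-++ u (x ∷ []))) r′) }
    ; light = λ A T Z eq bad r → light (reverse Z) (reverse T) (reverse A)
        (trans (sym (reverse-++ T Z)) (trans (cong reverse (sym eq)) (reverse-++ A T)))
        (subst₂′ Bad (trans (sym (period A T Z eq)) (sym (wt-reverse ω Z))) (sym (wt-reverse ω T)) bad)
        (subst R (trans (cong reverse eq) (reverse-++ T Z)) r)
    }
    where
    open Language L
    subst₂′ : ∀ (P : ℕ → ℕ → Set) {x y z t} → x ≡ y → z ≡ t → P x z → P y t
    subst₂′ P refl refl p = p
    rev₃ : ∀ u v w → reverse (u ++ v ++ w) ≡ reverse w ++ reverse v ++ reverse u
    rev₃ u v w = trans (reverse-++ u (v ++ w))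
      (trans (cong (_++ reverse u) (reverse-++ v w)) (++-assoc (reverse w) _ _))
    period : ∀ A T Z → A ++ T ≡ T ++ Z → wt ω Z ≡ wt ω A
    period A T Z eq = +-cancelʳ-≡ (wt ω T) (wt ω Z) (wt ω A) (trans (+-comm (wt ω Z) _)
      (trans (sym (wt-++ ω T Z)) (trans (cong (wt ω) (sym eq)) (wt-++ ω A T))))

-- Search for words without infinite extension

-- big A T is a decidable sufficient condition for Bad |A| |T|

module Search (depth : ℕ) (big : FinWord → FinWord → Bool) where

  -- Here `d` is `u` without its first `p` letters, so the common prefix of `u` and `d` is the tail
  -- of the longest repetition of period `p` at the start of `u`, up to the cut-off.
  repFrom : ℕ → ℕ → FinWord → FinWord → Bool
  repFrom zero p d u = false
  repFrom (suc k) p [] u = false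
  repFrom (suc k) p (x ∷ d) u = big (take p u) (lcp 60 u (x ∷ d)) ∨ repFrom k (suc p) d u

  rep : FinWord → Bool
  rep [] = false
  rep u@(_ ∷ d) = repFrom 40 1 d u

  -- Looking at prefixes is enough: words grow at the front, so a new violation starts there.
  bad : List FinWord → FinWord → Bool
  bad X u = any (λ x → isPrefix x u) X ∨ rep u

  badSuffix : List FinWord → FinWord → Bool
  badSuffix X [] = bad X []
  badSuffix X u@(_ ∷ v) = bad X u ∨ badSuffix X v

  -- u and v are reverses of each other, and so are the words of X and Y: swapping
  -- them turns extensions to the right into extensions to the left.
  kill : ℕ → List FinWord → List FinWord → FinWord → FinWord → Bool
  killBy : ℕ → List FinWord → List FinWord → FinWord → FinWord → Letter → Bool
  kill zero X Y u v = false
  kill (suc n) X Y u v = killBy n X Y u v 𝟎 ∧ killBy n X Y u v 𝟏 ∧ killBy n X Y u v 𝟐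
  killBy n X Y u v x = bad X (x ∷ u) ∨ kill n Y X (v ∷ʳ x) (x ∷ u)

  -- As `kill` inspects only words with a new first letter, `u` itself is scanned beforehand.
  dead : List FinWord → FinWord → Bool
  dead X u = badSuffix X u ∨ kill depth X (map reverse X) u (reverse u)

  module Soundness (Bad : ℕ → ℕ → Set) (ω : Weight)
    (big⇒Bad : ∀ A T → 1 ≤ length A → length A ≤ 40 → length T ≤ 60 → big A T ≡ true → Bad (wt ω A) (wt ω T))
    where
    open Avoiding Bad
    open Language

    -- Both `T` and `A ++ T` are prefixes of `A ++ v`, so the shorter is a prefix of the longer;
    -- what remains is the `Z` of `light`.
    lcp-rep-sound : ∀ {R} → Language ω R → ∀ A v → 1 ≤ length A → length A ≤ 40 →
                    big A (lcp 60 (A ++ v) v) ≡ true → ¬ R (A ++ v)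
    lcp-rep-sound {R} L A v A≥1 A≤40 big≡ r with lcp-prefixˡ 60 (A ++ v) v | lcp-prefixʳ 60 (A ++ v) v
    ... | w , Av≡Tw | z , v≡Tz with prefix-of-prefix T (A ++ T) (trans (sym Av≡Tw) Av≡ATz) T≤AT
      where
      T = lcp 60 (A ++ v) v
      Av≡ATz : A ++ v ≡ (A ++ T) ++ z
      Av≡ATz = trans (cong (A ++_) v≡Tz) (sym (++-assoc A T z))
      T≤AT : length T ≤ length (A ++ T)
      T≤AT = ≤-trans (m≤n+m _ (length A)) (≤-reflexive (sym (length-++ A)))
    ... | Z , AT≡TZ = light L A T Z AT≡TZ (big⇒Bad A T A≥1 A≤40 (length-lcp 60 (A ++ v) v) big≡)
        (prefix L z (subst R (trans (cong (A ++_) v≡Tz) (sym (++-assoc A T z))) r))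
      where
      T = lcp 60 (A ++ v) v

    -- Since a test consumes a unit of fuel, `k + p ≤ 41` gives `p ≤ 40` whenever a period is
    -- tested.
    repFrom-sound : ∀ {R} → Language ω R → ∀ k p d u → repFrom k p d u ≡ true →
                    d ≡ drop p u → 1 ≤ p → k + p ≤ 41 → ¬ R u
    repFrom-sound {R} L (suc k) p (x ∷ d) u eq d≡ p≥1 le r with ∨-true {big (take p u) (lcp 60 u (x ∷ d))} eq
    ... | inj₂ rest = repFrom-sound L k (suc p) d u rest (drop-suc p u d≡) (m≤n⇒m≤1+n p≥1)
                        (subst (_≤ 41) (sym (+-suc k p)) le) r
      where
      drop-suc : ∀ p (u : FinWord) {x d} → x ∷ d ≡ drop p u → d ≡ drop (suc p) u
      drop-suc zero (y ∷ u) refl = refl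
      drop-suc (suc p) (y ∷ u) eq = drop-suc p u eq
    ... | inj₁ big≡ = lcp-rep-sound L (take p u) (x ∷ d) (nonempty-take p u d≡ p≥1)
        (≤-trans (length-take≤ p u) (≤-pred (≤-trans (s≤s (m≤n+m p k)) le)))
        (subst (λ v → big (take p u) (lcp 60 v (x ∷ d)) ≡ true) u≡ big≡) (subst R u≡ r)
      where
      u≡ : u ≡ take p u ++ x ∷ d
      u≡ = trans (sym (take++drop≡id p u)) (cong (take p u ++_) (sym d≡))
      nonempty-take : ∀ p (u : FinWord) {x d} → x ∷ d ≡ drop p u → 1 ≤ p → 1 ≤ length (take p u)
      nonempty-take (suc p) (_ ∷ u) _ _ = s≤s z≤n
      length-take≤ : ∀ p (u : FinWord) → length (take p u) ≤ p
      length-take≤ p u = ≤-trans (≤-reflexive (length-take p u)) (m⊓n≤m p _)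

    rep-sound : ∀ {R} → Language ω R → ∀ u → rep u ≡ true → ¬ R u
    rep-sound L u@(_ ∷ d) eq = repFrom-sound L 40 1 d u eq refl ≤-refl ≤-refl

    bad-sound : ∀ {R} → Language ω R → ∀ {X} → All (¬_ ∘ R) X → ∀ u → bad X u ≡ true → ¬ R u
    bad-sound L {X} ¬X u eq r with ∨-true {any (λ x → isPrefix x u) X} eq
    ... | inj₂ rep≡ = rep-sound L u rep≡ r
    ... | inj₁ any≡ with any-true (λ x → isPrefix x u) X any≡
    ... | x , x∈X , pre with isPrefix-sound x u pre
    ... | w , refl = All.lookup ¬X x∈X (prefix L w r)

    badSuffix-sound : ∀ {R} → Language ω R → ∀ {X} → All (¬_ ∘ R) X → ∀ u → badSuffix X u ≡ true → ¬ R u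
    badSuffix-sound L ¬X [] = bad-sound L ¬X []
    badSuffix-sound L {X} ¬X u@(x ∷ v) eq r with ∨-true {bad X u} eq
    ... | inj₁ bad≡ = bad-sound L ¬X u bad≡ r
    ... | inj₂ rest = badSuffix-sound L ¬X v rest (suffix L (x ∷ []) r)

    kill-sound : ∀ n {R} → Language ω R → ∀ {X Y} → All (¬_ ∘ R) X → All (¬_ ∘ R ∘ reverse) Y →
                 ∀ u v → v ≡ reverse u → kill n X Y u v ≡ true → ¬ R u
    killBy-sound : ∀ n {R} → Language ω R → ∀ {X Y} → All (¬_ ∘ R) X → All (¬_ ∘ R ∘ reverse) Y →
                   ∀ u v → v ≡ reverse u → ∀ x → killBy n X Y u v x ≡ true → ¬ R (x ∷ u)
    kill-sound (suc n) L {X} {Y} ¬X ¬Y u v v≡ eq r with ∧-true {killBy n X Y u v 𝟎} eq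
    ... | eqa , rest with ∧-true {killBy n X Y u v 𝟏} rest
    ... | eqb , eqc = left L u r λ
      { (𝟎 , r′) → killBy-sound n L ¬X ¬Y u v v≡ 𝟎 eqa r′
      ; (𝟏 , r′) → killBy-sound n L ¬X ¬Y u v v≡ 𝟏 eqb r′
      ; (𝟐 , r′) → killBy-sound n L ¬X ¬Y u v v≡ 𝟐 eqc r′ }
    killBy-sound n {R} L {X} ¬X ¬Y u v v≡ x eq r with ∨-true {bad X (x ∷ u)} eq
    ... | inj₁ bad≡ = bad-sound L ¬X (x ∷ u) bad≡ r
    ... | inj₂ kill≡ = kill-sound n (reverse-language L) ¬Y
        (All.map (λ {w} ¬w r′ → ¬w (subst R (reverse-involutive w) r′)) ¬X)
        (v ∷ʳ x) (x ∷ u) (trans (sym (reverse-involutive (x ∷ u))) (cong reverse (sym vx≡))) kill≡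
        (subst R (trans (sym (reverse-involutive (x ∷ u))) (cong reverse (sym vx≡))) r)
      where
      vx≡ : v ∷ʳ x ≡ reverse (x ∷ u)
      vx≡ = trans (cong (_∷ʳ x) v≡) (sym (unfold-reverse x u))

    dead-sound : ∀ {R} → Language ω R → ∀ {X} → All (¬_ ∘ R) X → ∀ u → dead X u ≡ true → ¬ R u
    dead-sound {R} L {X} ¬X u eq =
      [ badSuffix-sound L ¬X u
      , kill-sound depth L ¬X (map⁺ (All.map (λ {w} ¬w r → ¬w (subst R (reverse-involutive w) r)) ¬X)) u (reverse u) refl
      ]′ (∨-true {badSuffix X u} eq)

-- Coding by first returns

letters : List Letter
letters = 𝟎 ∷ 𝟏 ∷ 𝟐 ∷ []

-- x stands for the first return f ∷ blk x to the letter f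
module Coding (f : Letter) (blk : Letter → FinWord) where

  image : FinWord → FinWord
  image [] = []
  image (x ∷ u) = (f ∷ blk x) ++ image u

  -- The closing `f` completes the last return. It makes `enc v` a factor of `enc (u ++ v ++ w)`,
  -- and it gives every code an `f` at both ends, where the search for further returns can start.
  enc : FinWord → FinWord
  enc u = image u ∷ʳ f

  weight : Weight → Weight
  weight ω x = ω f + wt ω (blk x)

  image-++ : ∀ u v → image (u ++ v) ≡ image u ++ image v
  image-++ [] v = refl
  image-++ (x ∷ u) v = trans (cong ((f ∷ blk x) ++_) (image-++ u v)) (sym (++-assoc (f ∷ blk x) _ _))

  wt-image : ∀ ω u → wt ω (image u) ≡ wt (weight ω) u
  wt-image ω [] = refl
  wt-image ω (x ∷ u) = trans (wt-++ ω (f ∷ blk x) (image u)) (cong (weight ω x +_) (wt-image ω u))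

  enc-head : ∀ u → ∃ λ t → enc u ≡ f ∷ t
  enc-head [] = [] , refl
  enc-head (x ∷ u) = (blk x ++ image u) ∷ʳ f , refl

  enc-∷ : ∀ x u → enc (x ∷ u) ≡ f ∷ blk x ++ enc u
  enc-∷ x u = ++-assoc (f ∷ blk x) (image u) (f ∷ [])

  enc-++ : ∀ u v → enc (u ++ v) ≡ image u ++ enc v
  enc-++ u v = trans (cong (_∷ʳ f) (image-++ u v)) (++-assoc (image u) _ _)

  reverse-enc : ∀ u → reverse (enc u) ≡ f ∷ reverse (image u)
  reverse-enc u = reverse-++ (image u) (f ∷ [])

  reverse-enc-∷ʳ : ∀ u x → reverse (enc (u ∷ʳ x)) ≡ f ∷ reverse (blk x) ++ reverse (enc u)
  reverse-enc-∷ʳ u x = begin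
    reverse (enc (u ∷ʳ x))                                     ≡⟨ reverse-enc (u ∷ʳ x) ⟩
    f ∷ reverse (image (u ∷ʳ x))                               ≡⟨ cong (λ z → f ∷ reverse z) (image-++ u (x ∷ [])) ⟩
    f ∷ reverse (image u ++ (f ∷ blk x) ++ [])                 ≡⟨ cong (λ z → f ∷ reverse (image u ++ z)) (++-identityʳ (f ∷ blk x)) ⟩
    f ∷ reverse (image u ++ (f ∷ blk x))                       ≡⟨ cong (f ∷_) (reverse-++ (image u) (f ∷ blk x)) ⟩
    f ∷ reverse (f ∷ blk x) ++ reverse (image u)               ≡⟨ cong (λ z → f ∷ z ++ reverse (image u)) (unfold-reverse f (blk x)) ⟩
    f ∷ (reverse (blk x) ∷ʳ f) ++ reverse (image u)            ≡⟨ cong (f ∷_) (++-assoc (reverse (blk x)) _ _) ⟩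
    f ∷ reverse (blk x) ++ f ∷ reverse (image u)               ≡⟨ cong (λ z → f ∷ reverse (blk x) ++ z) (sym (reverse-enc u)) ⟩
    f ∷ reverse (blk x) ++ reverse (enc u)                     ∎
    where open ≡-Reasoning

-- words absent from the fixed point of h
forbidden : List FinWord
forbidden = (𝟎 ∷ 𝟎 ∷ []) ∷ (𝟏 ∷ 𝟏 ∷ []) ∷ (𝟐 ∷ 𝟐 ∷ []) ∷ (𝟐 ∷ 𝟎 ∷ []) ∷ (𝟐 ∷ 𝟏 ∷ 𝟐 ∷ [])
  ∷ (𝟎 ∷ 𝟏 ∷ 𝟎 ∷ 𝟏 ∷ []) ∷ (𝟎 ∷ 𝟐 ∷ 𝟏 ∷ 𝟎 ∷ 𝟐 ∷ []) ∷ []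

module Derivation (depth width : ℕ) (big : FinWord → FinWord → Bool) where
  open Search depth big

  -- Reads leftwards from an `f`, and `s` is what has been read. Every branch has to die or to meet
  -- the previous `f` with `s` in `S`.
  returnsTo : ℕ → List FinWord → Letter → List FinWord → FinWord → Bool
  returnsBy : ℕ → List FinWord → Letter → List FinWord → FinWord → Letter → Bool
  returnsTo zero X f S s = dead X (s ∷ʳ f)
  returnsTo (suc n) X f S s = returnsBy n X f S s 𝟎 ∧ returnsBy n X f S s 𝟏 ∧ returnsBy n X f S s 𝟐
  returnsBy n X f S s x = bad X (x ∷ s ∷ʳ f) ∨
    (if x == f then any (_==ʷ s) S ∨ dead X (x ∷ s ∷ʳ f) else returnsTo n X f S (x ∷ s))

  -- The third test forces `f` to occur: with `f` forbidden as well, not even the empty word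
  -- survives.
  derivable : List FinWord → Letter → (Letter → FinWord) → Bool
  derivable X f blk =
    returnsTo width X f (map blk letters) [] ∧
    returnsTo width (map reverse X) f (map (reverse ∘ blk) letters) [] ∧
    dead ((f ∷ []) ∷ X) [] ∧
    all (λ w → dead X (Coding.enc f blk w)) forbidden

  module DerivationSoundness (Bad : ℕ → ℕ → Set) (ω : Weight)
    (big⇒Bad : ∀ A T → 1 ≤ length A → length A ≤ 40 → length T ≤ 60 → big A T ≡ true → Bad (wt ω A) (wt ω T))
    where
    open Avoiding Bad
    open Language
    open Soundness Bad ω big⇒Bad public

    returnsTo-sound : ∀ {R} → Language ω R → ∀ {X} → All (¬_ ∘ R) X → ∀ n f S s → returnsTo n X f S s ≡ true →
      ∀ t → R (s ++ f ∷ t) → ¬ ¬ ∃ λ s′ → s′ ∈ S × R (f ∷ s′ ++ f ∷ t)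
    returnsBy-sound : ∀ {R} → Language ω R → ∀ {X} → All (¬_ ∘ R) X → ∀ n f S s x → returnsBy n X f S s x ≡ true →
      ∀ t → R (x ∷ s ++ f ∷ t) → ¬ ¬ ∃ λ s′ → s′ ∈ S × R (f ∷ s′ ++ f ∷ t)
    returnsTo-sound {R} L ¬X zero f S s eq t r _ =
      dead-sound L ¬X (s ∷ʳ f) eq (prefix L t (subst R (sym (++-assoc s (f ∷ []) t)) r))
    returnsTo-sound L {X} ¬X (suc n) f S s eq t r k with ∧-true {returnsBy n X f S s 𝟎} eq
    ... | eqa , rest with ∧-true {returnsBy n X f S s 𝟏} rest
    ... | eqb , eqc = left L (s ++ f ∷ t) r λ
      { (𝟎 , r′) → returnsBy-sound L ¬X n f S s 𝟎 eqa t r′ k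
      ; (𝟏 , r′) → returnsBy-sound L ¬X n f S s 𝟏 eqb t r′ k
      ; (𝟐 , r′) → returnsBy-sound L ¬X n f S s 𝟐 eqc t r′ k }
    returnsBy-sound {R} L {X} ¬X n f S s x eq t r k with ∨-true {bad X (x ∷ s ∷ʳ f)} eq
    ... | inj₁ bad≡ = bad-sound L ¬X (x ∷ s ∷ʳ f) bad≡ (prefix L t (subst R (cong (x ∷_) (sym (++-assoc s (f ∷ []) t))) r))
    ... | inj₂ rest with x == f in x==f
    ... | false = returnsTo-sound L ¬X n f S (x ∷ s) rest t r k
    ... | true with ==⇒≡ {x} {f} x==f
    ... | refl with ∨-true {any (_==ʷ s) S} rest
    ... | inj₂ dead≡ = dead-sound L ¬X (x ∷ s ∷ʳ f) dead≡ (prefix L t (subst R (cong (x ∷_) (sym (++-assoc s (f ∷ []) t))) r))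
    ... | inj₁ any≡ with any-true (_==ʷ s) S any≡
    ... | s′ , s′∈S , s′≡ with ==ʷ⇒≡ {s′} {s} s′≡
    ... | refl = k (s , s′∈S , r)

    -- A code begins and ends with `f`, so the search for returns extends it on either side by one
    -- of the three returns. A repetition of code letters maps to a repetition of images with the
    -- same weights, hence `light` is inherited.
    derive : ∀ {R} → Language ω R → ∀ {X} → All (¬_ ∘ R) X → ∀ f blk → derivable X f blk ≡ true →
      Language (Coding.weight f blk ω) (R ∘ Coding.enc f blk) × All (¬_ ∘ R ∘ Coding.enc f blk) forbidden
    derive {R} L {X} ¬X f blk eq with ∧-true {returnsTo width X f (map blk letters) []} eq
    ... | ret , rest₁ with ∧-true {returnsTo width (map reverse X) f (map (reverse ∘ blk) letters) []} rest₁
    ... | ret′ , rest₂ with ∧-true {dead ((f ∷ []) ∷ X) []} rest₂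
    ... | occurs , forb = record
      -- The code of the empty word is `f`, so this is the occurrence of `f`.
      { nonempty = λ ¬f → nonempty L (dead-sound L (¬f ∷ ¬X) [] occurs)
      ; factor = λ u {v} w r → factor′ u v w r
      ; left = left′
      ; right = right′
      ; light = light′
      } , All.map (λ {w} dead≡ → dead-sound L ¬X (enc w) dead≡) (all-true (λ w → dead X (enc w)) forbidden forb)
      where
      open Coding f blk
      factor′ : ∀ u v w → R (enc (u ++ v ++ w)) → R (enc v)
      factor′ u v w r with enc-head w
      ... | t , enc-w = factor L (image u) t (subst R eq′ r)
        where
        eq′ : enc (u ++ v ++ w) ≡ image u ++ enc v ++ t
        eq′ = trans (enc-++ u (v ++ w)) (cong (image u ++_) (trans (enc-++ v w)
          (trans (cong (image v ++_) enc-w) (sym (++-assoc (image v) (f ∷ []) t)))))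
      left′ : ∀ u → R (enc u) → ¬ ¬ ∃ λ x → R (enc (x ∷ u))
      left′ u r k with enc-head u
      ... | t , enc-u = returnsTo-sound L ¬X width f (map blk letters) [] ret t (subst R enc-u r)
        λ { (s , s∈ , r′) → found s s∈ r′ }
        where
        found : ∀ s → s ∈ map blk letters → ¬ R (f ∷ s ++ f ∷ t)
        found s s∈ r′ with ∈-map⁻ blk s∈
        ... | x , _ , refl = k (x , subst R (trans (cong (λ z → f ∷ blk x ++ z) (sym enc-u)) (sym (enc-∷ x u))) r′)
      right′ : ∀ u → R (enc u) → ¬ ¬ ∃ λ x → R (enc (u ∷ʳ x))
      right′ u r k = returnsTo-sound (reverse-language L)
        (map⁺ (All.map (λ {w} ¬w r → ¬w (subst R (reverse-involutive w) r)) ¬X)) width f _ [] ret′ (reverse (image u))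
        (subst R (trans (sym (reverse-involutive (enc u))) (cong reverse (reverse-enc u))) r)
        λ { (s , s∈ , r′) → found s s∈ r′ }
        where
        found : ∀ s → s ∈ map (reverse ∘ blk) letters → ¬ R (reverse (f ∷ s ++ f ∷ reverse (image u)))
        found s s∈ r′ with ∈-map⁻ (reverse ∘ blk) s∈
        ... | x , _ , refl = k (x , subst R
          (trans (cong reverse (trans (cong (λ z → f ∷ reverse (blk x) ++ z) (sym (reverse-enc u))) (sym (reverse-enc-∷ʳ u x))))
                 (reverse-involutive (enc (u ∷ʳ x)))) r′)
      light′ : ∀ A T Z → A ++ T ≡ T ++ Z → Bad (wt (weight ω) A) (wt (weight ω) T) → ¬ R (enc (A ++ T))
      light′ A T Z eq bad r = light L (image A) (image T) (image Z)
        (trans (sym (image-++ A T)) (trans (cong image eq) (image-++ T Z)))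
        (subst (λ n → Bad n (wt ω (image T))) (sym (wt-image ω A)) (subst (Bad (wt (weight ω) A)) (sym (wt-image ω T)) bad))
        (prefix L (f ∷ []) (subst (λ z → R (z ∷ʳ f)) (image-++ A T) r))

-- Symmetries, decision trees and their checker

-- The two transpositions generate all renamings of the letters; together with reversal they
-- preserve `Language unit` and `Counted`.
data Symmetry : Set where
  σ₀₁ σ₁₂ rev : Symmetry

rename : Symmetry → Letter → Letter
rename σ₀₁ 𝟎 = 𝟏
rename σ₀₁ 𝟏 = 𝟎
rename σ₁₂ 𝟏 = 𝟐
rename σ₁₂ 𝟐 = 𝟏
rename _ x = x

rename-involutive : ∀ g x → rename g (rename g x) ≡ x
rename-involutive σ₀₁ 𝟎 = refl
rename-involutive σ₀₁ 𝟏 = refl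
rename-involutive σ₀₁ 𝟐 = refl
rename-involutive σ₁₂ 𝟎 = refl
rename-involutive σ₁₂ 𝟏 = refl
rename-involutive σ₁₂ 𝟐 = refl
rename-involutive rev 𝟎 = refl
rename-involutive rev 𝟏 = refl
rename-involutive rev 𝟐 = refl

act : Symmetry → FinWord → FinWord
act rev u = reverse u
act g u = map (rename g) u

unit : Weight
unit _ = 1

wt-unit : ∀ u → wt unit u ≡ length u
wt-unit [] = refl
wt-unit (_ ∷ u) = cong suc (wt-unit u)

map-rename-involutive : ∀ g u → map (rename g) (map (rename g) u) ≡ u
map-rename-involutive g [] = refl
map-rename-involutive g (x ∷ u) = cong₂ _∷_ (rename-involutive g x) (map-rename-involutive g u)

act-involutive : ∀ g u → act g (act g u) ≡ u
act-involutive σ₀₁ = map-rename-involutive σ₀₁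
act-involutive σ₁₂ = map-rename-involutive σ₁₂
act-involutive rev = reverse-involutive

act-injective : ∀ g {u v} → act g u ≡ act g v → u ≡ v
act-injective g {u} {v} eq = trans (sym (act-involutive g u)) (trans (cong (act g) eq) (act-involutive g v))

length-act : ∀ g u → length (act g u) ≡ length u
length-act σ₀₁ = length-map (rename σ₀₁)
length-act σ₁₂ = length-map (rename σ₁₂)
length-act rev = length-reverse

-- A decision tree on whether words v occur; contra v and count n close a branch because v occurs
-- but has no infinite extension, respectively because 2n + 2 words of length n occur, and
-- case k refers back to the k-th previous tree. The digits 1, 2, 3 denote the letters 𝟎, 𝟏, 𝟐.

data Tree : Set where
  split  : ℕ → Tree → Tree → Tree
  contra : ℕ → Tree
  count  : ℕ → Tree
  via    : Symmetry → Tree → Tree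
  case   : ℕ → Tree
  leaf   : Letter → ℕ → ℕ → ℕ → Tree

digit : ℕ → Letter
digit 1 = 𝟎
digit 2 = 𝟏
digit _ = 𝟐

digits : ℕ → ℕ → FinWord → FinWord
digits _ zero u = u
digits zero (suc n) u = u
digits (suc k) m@(suc _) u = digits k (m / 10) (digit (m % 10) ∷ u)

-- The numeral 0 gives the empty word, used as an empty block and in `contra 0`. The fuel 30 is
-- ample: no numeral of the certificate has more than twelve digits.
word : ℕ → FinWord
word n = digits 30 n []

factors : ℕ → FinWord → List FinWord
factors n [] = []
factors n u@(_ ∷ v) = if n ≤ᵇ length u then take n u ∷ factors n v else []

insert : FinWord → List FinWord → List FinWord
insert u L = if any (u ==ʷ_) L then L else u ∷ L

insertAll : List FinWord → List FinWord → List FinWord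
insertAll [] L = L
insertAll (u ∷ us) L = insert u (insertAll us L)

allFactors : ℕ → List FinWord → List FinWord
allFactors n [] = []
allFactors n (y ∷ Y) = insertAll (factors n y) (allFactors n Y)

-- Words known to be absent and words known to occur.
State : Set
State = List FinWord × List FinWord

blocks : ℕ → ℕ → ℕ → Letter → FinWord
blocks x y z 𝟎 = word x
blocks x y z 𝟏 = word y
blocks x y z 𝟐 = word z

record Node : Set where
  constructor node
  field
    absent present : List ℕ
    tree : Tree

module Checker (depth width : ℕ) (big : FinWord → FinWord → Bool) where
  open Search depth big
  open Derivation depth width big

  -- Weakening: a word that the earlier case wants absent need only contain an absent word or a
  -- large repetition, and a word that it wants present need only be a factor of a present one.
  implied : List State → ℕ → List FinWord → List FinWord → Bool
  implied [] _ X Y = false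
  implied (_ ∷ E) (suc n) X Y = implied E n X Y
  implied ((X′ , Y′) ∷ _) zero X Y = all (badSuffix X) X′ ∧ all (λ y → any (isInfix y) Y) Y′

  check : List State → Tree → List FinWord → List FinWord → Bool
  check E (split v t₁ t₂) X Y = check E t₁ X (word v ∷ Y) ∧ check E t₂ (word v ∷ X) Y
  check E (contra v) X Y = any (isInfix (word v)) Y ∧ dead X (word v)
  check E (count n) X Y = suc (2 * n) <ᵇ length (allFactors n Y)
  check E (via g t) X Y = check E t (map (act g) X) (map (act g) Y)
  check E (case k) X Y = implied E k X Y
  check E (leaf f x y z) X Y =
    derivable X f (blocks x y z) ∧ all (λ l → length (blocks x y z l) ≤ᵇ 8) letters

  checkAll : List State → List Node → Tree → Bool
  checkAll E [] t = check E t [] ([] ∷ [])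
  checkAll E (node X Y t ∷ ns) root =
    check E t (map word X) (map word Y) ∧ checkAll ((map word X , map word Y) ∷ E) ns root

-- Soundness of the checker

==ʷ-refl : ∀ u → (u ==ʷ u) ≡ true
==ʷ-refl [] = refl
==ʷ-refl (𝟎 ∷ u) = ==ʷ-refl u
==ʷ-refl (𝟏 ∷ u) = ==ʷ-refl u
==ʷ-refl (𝟐 ∷ u) = ==ʷ-refl u

any-false : ∀ u L → any (u ==ʷ_) L ≡ false → All (u ≢_) L
any-false u [] _ = []
any-false u (v ∷ L) eq with u ==ʷ v in u≡v
... | false = (λ { refl → true≢false (trans (sym (==ʷ-refl u)) u≡v) }) ∷ any-false u L eq
  where
  true≢false : true ≢ false
  true≢false ()

insert-unique : ∀ u L → Unique L → Unique (insert u L)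
insert-unique u L L! with any (u ==ʷ_) L in eq
... | true = L!
... | false = any-false u L eq ∷ L!

insertAll-unique : ∀ us L → Unique L → Unique (insertAll us L)
insertAll-unique [] L L! = L!
insertAll-unique (u ∷ us) L L! = insert-unique u _ (insertAll-unique us L L!)

allFactors-unique : ∀ n Y → Unique (allFactors n Y)
allFactors-unique n [] = []
allFactors-unique n (y ∷ Y) = insertAll-unique (factors n y) _ (allFactors-unique n Y)

insertAll-All : ∀ {P : FinWord → Set} us L → All P us → All P L → All P (insertAll us L)
insertAll-All [] L _ pL = pL
insertAll-All (u ∷ us) L (pu ∷ pus) pL with any (u ==ʷ_) (insertAll us L)
... | true = insertAll-All us L pus pL
... | false = pu ∷ insertAll-All us L pus pL

factors-All : ∀ {P : FinWord → Set} → (∀ u v → P (u ++ v) → P u) → (∀ x v → P (x ∷ v) → P v) →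
              ∀ n u → P u → All (λ v → P v × length v ≡ n) (factors n u)
factors-All pre suf n [] _ = []
factors-All {P} pre suf n u@(x ∷ v) pu with n ≤ᵇ length u in le
... | false = []
... | true = (pre (take n u) (drop n u) (subst P (sym (take++drop≡id n u)) pu)
             , trans (length-take n u) (m≤n⇒m⊓n≡m (≤ᵇ⇒≤ n _ (subst Data.Bool.T (sym le) _))))
             ∷ factors-All pre suf n v (suf x v pu)

-- Duplicate-free lists express the bound without an enumeration of `R`, whose membership is not
-- decidable.
Counted : (FinWord → Set) → Set
Counted R = ∀ n L → Unique L → All R L → All (λ u → length u ≡ n) L → length L ≤ suc (2 * n)

counted-act : ∀ g {R} → Counted R → Counted (R ∘ act g)
counted-act g cnt n L L! rL len = subst (_≤ suc (2 * n)) (length-map (act g) L)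
  (cnt n (map (act g) L) (Unique.map⁺ (act-injective g) L!) (map⁺ rL)
    (map⁺ (All.map (λ {u} eq → trans (length-act g u) eq) len)))

module CheckerSoundness (depth width : ℕ) (big : FinWord → FinWord → Bool) (Bad : ℕ → ℕ → Set)
  (big⇒Bad : ∀ A T → 1 ≤ length A → length A ≤ 40 → length T ≤ 60 → big A T ≡ true → Bad (wt unit A) (wt unit T))
  (derived⇒⊥ : ∀ ω R → (∀ x → 1 ≤ ω x × ω x ≤ 9) → Avoiding.Language Bad ω R → All (¬_ ∘ R) forbidden → ⊥)
  where
  open Avoiding Bad
  open Checker depth width big
  open Derivation depth width big
  open DerivationSoundness Bad unit big⇒Bad
  open Language
  open Search depth big

  -- Confined to `unit`, because a general weight distinguishes the letters.
  rename-language : ∀ g {R} → Language unit R → Language unit (R ∘ map (rename g))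
  rename-language g {R} L = record
    { nonempty = nonempty L
    ; factor = λ u {v} w r → factor L (map ρ u) (map ρ w)
        (subst R (trans (map-++ ρ u (v ++ w)) (cong (map ρ u ++_) (map-++ ρ v w))) r)
    ; left = λ u r k → left L (map ρ u) r λ { (x , r′) → k (ρ x , subst (λ y → R (y ∷ map ρ u)) (sym (rename-involutive g x)) r′) }
    ; right = λ u r k → right L (map ρ u) r λ { (x , r′) → k (ρ x ,
        subst R (sym (trans (map-++ ρ u (ρ x ∷ [])) (cong (λ y → map ρ u ∷ʳ y) (rename-involutive g x)))) r′) }
    ; light = λ A T Z eq bad r → light L (map ρ A) (map ρ T) (map ρ Z)
        (trans (sym (map-++ ρ A T)) (trans (cong (map ρ) eq) (map-++ ρ T Z)))
        (subst (λ n → Bad n _) (wt-map A) (subst (Bad _) (wt-map T) bad))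
        (subst R (map-++ ρ A T) r)
    }
    where
    ρ = rename g
    wt-map : ∀ u → wt unit u ≡ wt unit (map ρ u)
    wt-map u = trans (wt-unit u) (trans (sym (length-map ρ u)) (sym (wt-unit (map ρ u))))

  act-language : ∀ g {R} → Language unit R → Language unit (R ∘ act g)
  act-language σ₀₁ = rename-language σ₀₁
  act-language σ₁₂ = rename-language σ₁₂
  act-language rev = reverse-language

  Refuted : State → Set₁
  Refuted (X , Y) = ∀ {R} → Language unit R → Counted R → All (¬_ ∘ R) X → All R Y → ⊥

  implied-sound : ∀ E → All Refuted E → ∀ k X Y → implied E k X Y ≡ true → Refuted (X , Y)
  implied-sound (_ ∷ E) (_ ∷ refs) (suc k) X Y eq = implied-sound E refs k X Y eq
  implied-sound ((X′ , Y′) ∷ _) (ref ∷ _) zero X Y eq {R} L cnt ¬X RY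
    with ∧-true {all (badSuffix X) X′} eq
  ... | eqX , eqY = ref L cnt
    (All.map (λ {x} → badSuffix-sound L ¬X x) (all-true (badSuffix X) X′ eqX))
    (All.map present (all-true (λ y → any (isInfix y) Y) Y′ eqY))
    where
    present : ∀ {y} → any (isInfix y) Y ≡ true → R y
    present {y} eq with any-true (isInfix y) Y eq
    ... | z , z∈Y , inf with isInfix-sound y z inf
    ... | u , v , refl = factor L u v (All.lookup RY z∈Y)

  check-sound : ∀ E → All Refuted E → ∀ t X Y → check E t X Y ≡ true → Refuted (X , Y)
  check-sound E refs (split v t₁ t₂) X Y eq L cnt ¬X RY with ∧-true {check E t₁ X (word v ∷ Y)} eq
  -- The refutation of the first branch is itself a proof that `word v` is absent, so `R (word v)`
  -- need not be decided.
  ... | eq₁ , eq₂ = check-sound E refs t₂ (word v ∷ X) Y eq₂ L cnt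
    ((λ r → check-sound E refs t₁ X (word v ∷ Y) eq₁ L cnt ¬X (r ∷ RY)) ∷ ¬X) RY
  check-sound E refs (contra v) X Y eq L cnt ¬X RY with ∧-true {any (isInfix (word v)) Y} eq
  ... | inf≡ , dead≡ with any-true (isInfix (word v)) Y inf≡
  ... | z , z∈Y , inf with isInfix-sound (word v) z inf
  ... | u , w , refl = dead-sound L ¬X (word v) dead≡ (factor L u w (All.lookup RY z∈Y))
  check-sound E refs (count n) X Y eq {R} L cnt ¬X RY = <⇒≱ (<ᵇ⇒< _ _ (subst Data.Bool.T (sym eq) _))
    (cnt n (allFactors n Y) (allFactors-unique n Y) (All.map proj₁ facs) (All.map proj₂ facs))
    where
    facsAll : ∀ Y → All R Y → All (λ v → R v × length v ≡ n) (allFactors n Y)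
    facsAll [] _ = []
    facsAll (y ∷ Y) (r ∷ rs) = insertAll-All (factors n y) _
      (factors-All (λ u v → prefix L v) (λ x v → suffix L (x ∷ [])) n y r) (facsAll Y rs)
    facs : All (λ v → R v × length v ≡ n) (allFactors n Y)
    facs = facsAll Y RY
  check-sound E refs (via g t) X Y eq {R} L cnt ¬X RY =
    check-sound E refs t (map (act g) X) (map (act g) Y) eq (act-language g L) (counted-act g {R} cnt)
      (map⁺ (All.map (λ {x} ¬x r → ¬x (subst R (act-involutive g x) r)) ¬X))
      (map⁺ (All.map (λ {y} r → subst R (sym (act-involutive g y)) r) RY))
  check-sound E refs (case k) X Y eq = implied-sound E refs k X Y eq
  check-sound E refs (leaf f x y z) X Y eq {R} L cnt ¬X RY with ∧-true {derivable X f (blocks x y z)} eq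
  ... | der , short with derive L ¬X f (blocks x y z) der
  ... | L′ , ¬forb = derived⇒⊥ (Coding.weight f (blocks x y z) unit) (R ∘ Coding.enc f (blocks x y z)) bounds L′ ¬forb
    where
    shorts : All (λ l → (length (blocks x y z l) ≤ᵇ 8) ≡ true) letters
    shorts = all-true (λ l → length (blocks x y z l) ≤ᵇ 8) letters short
    short-blk : ∀ l → (length (blocks x y z l) ≤ᵇ 8) ≡ true
    short-blk 𝟎 with shorts
    ... | p ∷ _ = p
    short-blk 𝟏 with shorts
    ... | _ ∷ p ∷ _ = p
    short-blk 𝟐 with shorts
    ... | _ ∷ _ ∷ p ∷ _ = p
    bounds : ∀ l → 1 ≤ Coding.weight f (blocks x y z) unit l × Coding.weight f (blocks x y z) unit l ≤ 9
    bounds l = s≤s z≤n , s≤s (≤-trans (≤-reflexive (wt-unit (blocks x y z l))) (≤ᵇ⇒≤ _ 8 (subst Data.Bool.T (sym (short-blk l)) _)))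

  checkAll-sound : ∀ E → All Refuted E → ∀ ns root → Checker.checkAll depth width big E ns root ≡ true → Refuted ([] , [] ∷ [])
  checkAll-sound E refs [] root eq = check-sound E refs root [] ([] ∷ []) eq
  checkAll-sound E refs (node X Y t ∷ ns) root eq with ∧-true {check E t (map word X) (map word Y)} eq
  ... | eq₁ , eq₂ = checkAll-sound _ ((λ {R} → check-sound E refs t (map word X) (map word Y) eq₁ {R}) ∷ refs) ns root eq₂

-- The repetition tests and the certificate

-- Exponent `1 + |T| / |A|` at least 5/2.
long : FinWord → FinWord → Bool
long A [] = false
long A T@(_ ∷ _) = (3 * length A) ≤ᵇ (2 * length T)

occ : Letter → FinWord → ℕ
occ x [] = 0
occ 𝟎 (𝟎 ∷ u) = suc (occ 𝟎 u)
occ 𝟏 (𝟏 ∷ u) = suc (occ 𝟏 u)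
occ 𝟐 (𝟐 ∷ u) = suc (occ 𝟐 u)
occ x (_ ∷ u) = occ x u

-- The inequality of `long` for each letter separately; a nonnegative combination of the three gives
-- it for every weight.
heavy : FinWord → FinWord → Bool
heavy A [] = false
heavy A T@(_ ∷ _) = all (λ x → (3 * occ x A) ≤ᵇ (2 * occ x T)) letters

φ : Letter → FinWord
φ 𝟎 = 𝟏 ∷ 𝟐 ∷ 𝟏 ∷ []
φ 𝟏 = 𝟐 ∷ 𝟏 ∷ []
φ 𝟐 = 𝟏 ∷ []

-- Runs from the leaves of the case analysis to its top, as a case can only refer to earlier ones.
-- The last four nodes treat binary languages; the node before them treats the languages in which
-- all three letters occur.
cases : List Node
cases =
  node (22 ∷ 23 ∷ 32 ∷ 33 ∷ 212 ∷ 312 ∷ 313 ∷ 3113 ∷ [])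
    (1121 ∷ 1131 ∷ 1211 ∷ 1213 ∷ 1311 ∷ 2112 ∷ 2113 ∷ 2131 ∷ 3112 ∷ [])
    (leaf 𝟎 2 0 3) ∷
  node (22 ∷ 23 ∷ 32 ∷ 33 ∷ 212 ∷ 312 ∷ 313 ∷ 2113 ∷ 113113 ∷ 211211 ∷ 11311211 ∷ [])
    (11211213 ∷ 11213112 ∷ 11213113 ∷ 11311213 ∷ 12112131 ∷ 12131121 ∷ 12131131 ∷ 13112112 ∷
      13112131 ∷ 13113112 ∷ 21121311 ∷ 21311211 ∷ 21311213 ∷ 21311311 ∷ 31121121 ∷ 31121311 ∷
      31131121 ∷ [])
    (leaf 𝟏 11 1311 1311311) ∷
  node (22 ∷ 23 ∷ 32 ∷ 33 ∷ 212 ∷ 312 ∷ 313 ∷ 2113 ∷ 113113 ∷ 211211 ∷ [])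
    (1121121 ∷ 1121311 ∷ 1131121 ∷ 1211213 ∷ 1213112 ∷ 1213113 ∷ 1311211 ∷ 1311213 ∷ 1311311 ∷
      2112131 ∷ 2131121 ∷ 2131131 ∷ 3112112 ∷ 3112131 ∷ 3113112 ∷ [])
    (split 11211213 (split 11213112 (split 11213113 (split 12112131 (split 12131121 (split 12131131
      (split 13112112 (split 13112131 (split 13113112 (split 21121311 (split 21311311 (split
      31121121 (split 31121311 (split 31131121 (split 11311211 (split 11311213 (split 21311211
      (split 21311213 (count 8) (contra 11311211)) (contra 11311213)) (split 21311211 (contra
      21311211) (contra 1121121))) (split 11311213 (split 21311211 (split 21311213 (case 0) (contra
      1311213)) (contra 1311211)) (contra 1131121))) (contra 1131121)) (contra 1121311)) (contra
      1121121)) (contra 1311311)) (contra 1121311)) (contra 1311311)) (contra 1311213)) (contra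
      1311211)) (contra 1213113)) (contra 1213112)) (contra 1211213)) (contra 1121311)) (contra
      1121311)) (contra 1121121)) ∷
  node (22 ∷ 23 ∷ 32 ∷ 33 ∷ 212 ∷ 312 ∷ 313 ∷ 2113 ∷ 113113 ∷ 211211 ∷ [])
    (112112 ∷ 112131 ∷ 113112 ∷ 121121 ∷ 121311 ∷ 131121 ∷ 131131 ∷ 211213 ∷ 213112 ∷ 213113 ∷
      311211 ∷ 311213 ∷ 311311 ∷ [])
    (split 1121121 (split 1121311 (split 1131121 (split 1211213 (split 1213112 (split 1213113 (split
      1311211 (split 1311213 (split 1311311 (split 2112131 (split 2131121 (split 2131131 (split
      3112112 (split 3112131 (split 3113112 (case 0) (contra 113112)) (contra 112131)) (contra
      112112)) (contra 131131)) (contra 131121)) (contra 112131)) (contra 131131)) (contra 131121))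
      (contra 131121)) (contra 121311)) (contra 121311)) (contra 121121)) (contra 113112)) (contra
      112131)) (contra 112112)) ∷
  node (22 ∷ 23 ∷ 32 ∷ 33 ∷ 212 ∷ 312 ∷ 313 ∷ 2113 ∷ [])
    (11211 ∷ 11213 ∷ 11311 ∷ 12112 ∷ 12131 ∷ 13112 ∷ 13113 ∷ 21121 ∷ 21311 ∷ 31121 ∷ 31131 ∷ [])
    (split 113113 (contra 113113) (split 211211 (contra 211211) (split 112112 (split 112131 (split
      113112 (split 121121 (split 121311 (split 131121 (split 131131 (split 211213 (split 213112
      (split 213113 (split 311211 (split 311213 (split 311311 (case 0) (contra 11311)) (contra
      11213)) (contra 11211)) (contra 13113)) (contra 13112)) (contra 11213)) (contra 13113))
      (contra 13112)) (contra 12131)) (contra 12112)) (contra 11311)) (contra 11213)) (contra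
      11211)))) ∷
  node (22 ∷ 23 ∷ 32 ∷ 33 ∷ 212 ∷ 312 ∷ 313 ∷ 2113 ∷ [])
    (1121 ∷ 1131 ∷ 1211 ∷ 1213 ∷ 1311 ∷ 2112 ∷ 2131 ∷ 3112 ∷ 3113 ∷ [])
    (split 11211 (split 11213 (split 11311 (split 12112 (split 12131 (split 13112 (split 13113
      (split 21121 (split 21311 (split 31121 (split 31131 (case 0) (contra 1131)) (contra 1121))
      (contra 1311)) (contra 1121)) (contra 1311)) (contra 1311)) (contra 1213)) (contra 1211))
      (contra 1131)) (contra 1121)) (contra 1121)) ∷
  node (22 ∷ 23 ∷ 32 ∷ 33 ∷ 212 ∷ 312 ∷ 313 ∷ [])
    (112 ∷ 113 ∷ 121 ∷ 131 ∷ 211 ∷ 213 ∷ 311 ∷ [])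
    (split 1121 (split 1131 (split 1211 (split 1213 (split 1311 (split 2131 (split 3112 (split 2112
      (split 2113 (split 3113 (count 4) (case 5)) (split 3113 (case 0) (contra 113))) (split 2113
      (split 3113 (via rev (via σ₁₂ (case 5))) (contra 113)) (contra 113))) (contra 112)) (contra
      131)) (contra 131)) (contra 121)) (contra 121)) (contra 113)) (contra 112)) ∷
  node (22 ∷ 23 ∷ 32 ∷ 33 ∷ 212 ∷ 311 ∷ 313 ∷ 31213 ∷ [])
    (11211 ∷ 11213 ∷ 11312 ∷ 12112 ∷ 12113 ∷ 12131 ∷ 13121 ∷ 21121 ∷ 21131 ∷ 21312 ∷ 31211 ∷ [])
    (leaf 𝟎 0 2 3) ∷
  node (22 ∷ 23 ∷ 32 ∷ 33 ∷ 113 ∷ 212 ∷ 313 ∷ 31211 ∷ [])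
    (11211 ∷ 11213 ∷ 12112 ∷ 12131 ∷ 13112 ∷ 13121 ∷ 21121 ∷ 21311 ∷ 21312 ∷ 31121 ∷ 31213 ∷ [])
    (via rev (leaf 𝟏 131 1131 11)) ∷
  node (22 ∷ 23 ∷ 32 ∷ 33 ∷ 212 ∷ 311 ∷ 313 ∷ 11211 ∷ [])
    (11213 ∷ 11312 ∷ 12112 ∷ 12113 ∷ 12131 ∷ 13121 ∷ 21121 ∷ 21131 ∷ 21312 ∷ 31211 ∷ 31213 ∷ [])
    (via rev (leaf 𝟎 3 2 0)) ∷
  node (22 ∷ 23 ∷ 32 ∷ 33 ∷ 212 ∷ 311 ∷ 313 ∷ [])
    (1121 ∷ 1131 ∷ 1211 ∷ 1213 ∷ 1312 ∷ 2112 ∷ 2113 ∷ 2131 ∷ 3121 ∷ [])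
    (split 11312 (split 12112 (split 12113 (split 12131 (split 13121 (split 21121 (split 21131
      (split 21312 (split 31211 (split 11211 (split 11213 (split 31213 (count 5) (case 2)) (split
      31213 (via rev (case 1)) (contra 1213))) (split 11213 (split 31213 (case 0) (contra 1213))
      (contra 1121))) (contra 1211)) (contra 1312)) (contra 1131)) (contra 1121)) (contra 1312))
      (contra 1213)) (contra 1211)) (contra 1211)) (contra 1131)) ∷
  node (22 ∷ 23 ∷ 32 ∷ 33 ∷ 212 ∷ 311 ∷ 313 ∷ [])
    (112 ∷ 113 ∷ 121 ∷ 131 ∷ 211 ∷ 213 ∷ 312 ∷ [])
    (split 1121 (split 1131 (split 1211 (split 1213 (split 1312 (split 2112 (split 2113 (split 2131
      (split 3121 (case 0) (contra 121)) (contra 131)) (contra 113)) (contra 112)) (contra 131))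
      (contra 121)) (contra 121)) (contra 113)) (contra 112)) ∷
  node (22 ∷ 23 ∷ 32 ∷ 33 ∷ [])
    (11 ∷ 12 ∷ 13 ∷ 21 ∷ 31 ∷ [])
    (split 212 (contra 212) (split 313 (contra 313) (split 121 (split 131 (split 112 (split 113
      (split 211 (split 213 (split 311 (split 312 (count 3) (case 5)) (split 312 (case 0) (contra
      12))) (split 311 (split 312 (via rev (case 5)) (contra 12)) (contra 11))) (split 213 (split
      311 (split 312 (via σ₁₂ (case 0)) (contra 12)) (contra 11)) (contra 13))) (split 211 (split 213
      (split 311 (split 312 (via rev (case 0)) (contra 12)) (contra 11)) (contra 13)) (contra 11)))
      (split 113 (split 211 (split 213 (split 311 (split 312 (via rev (via σ₁₂ (case 0))) (contra
      12)) (contra 11)) (contra 13)) (contra 11)) (contra 11))) (contra 13)) (contra 12)))) ∷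
  node (22 ∷ 23 ∷ 31 ∷ 33 ∷ 213 ∷ [])
    (112 ∷ 113 ∷ 121 ∷ 132 ∷ 211 ∷ 212 ∷ 321 ∷ [])
    (via rev (leaf 𝟎 2 0 23)) ∷
  node (13 ∷ 22 ∷ 32 ∷ 33 ∷ 212 ∷ 3123 ∷ [])
    (1121 ∷ 1123 ∷ 1211 ∷ 1231 ∷ 2112 ∷ 2311 ∷ 2312 ∷ 3112 ∷ 3121 ∷ [])
    (leaf 𝟎 23 0 2) ∷
  node (13 ∷ 22 ∷ 32 ∷ 33 ∷ 212 ∷ 3121 ∷ [])
    (1121 ∷ 1123 ∷ 1211 ∷ 1231 ∷ 2112 ∷ 2311 ∷ 2312 ∷ 3112 ∷ 3123 ∷ [])
    (via rev (leaf 𝟏 13 113 11)) ∷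
  node (22 ∷ 23 ∷ 31 ∷ 33 ∷ 212 ∷ 1211 ∷ [])
    (1121 ∷ 1132 ∷ 1213 ∷ 1321 ∷ 2112 ∷ 2113 ∷ 2132 ∷ 3211 ∷ 3213 ∷ [])
    (leaf 𝟏 113 13 11) ∷
  node (22 ∷ 23 ∷ 31 ∷ 33 ∷ 212 ∷ [])
    (112 ∷ 113 ∷ 121 ∷ 132 ∷ 211 ∷ 213 ∷ 321 ∷ [])
    (split 1121 (split 1132 (split 1321 (split 2112 (split 2113 (split 2132 (split 3211 (split 1211
      (split 1213 (split 3213 (count 4) (via rev (case 2))) (split 3213 (via rev (case 1)) (contra
      213))) (split 1213 (split 3213 (case 0) (contra 213)) (contra 121))) (contra 211)) (contra
      132)) (contra 113)) (contra 112)) (contra 132)) (contra 113)) (contra 112)) ∷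
  node (13 ∷ 22 ∷ 32 ∷ 33 ∷ 311 ∷ [])
    (112 ∷ 121 ∷ 123 ∷ 211 ∷ 212 ∷ 231 ∷ 312 ∷ [])
    (via rev (leaf 𝟎 32 2 0)) ∷
  node (13 ∷ 22 ∷ 32 ∷ 33 ∷ 211 ∷ 2121 ∷ 3123 ∷ [])
    (1121 ∷ 1123 ∷ 1212 ∷ 1231 ∷ 2123 ∷ 2311 ∷ 2312 ∷ 3112 ∷ 3121 ∷ [])
    (via rev (leaf 𝟎 2 32 0)) ∷
  node (13 ∷ 22 ∷ 32 ∷ 33 ∷ 211 ∷ 2121 ∷ 3121 ∷ [])
    (1121 ∷ 1123 ∷ 1212 ∷ 1231 ∷ 2123 ∷ 2311 ∷ 2312 ∷ 3112 ∷ 3123 ∷ [])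
    (via rev (leaf 𝟏 13 113 1)) ∷
  node (13 ∷ 22 ∷ 32 ∷ 33 ∷ 211 ∷ 1123 ∷ 2121 ∷ [])
    (1121 ∷ 1212 ∷ 1231 ∷ 2123 ∷ 2311 ∷ 2312 ∷ 3112 ∷ 3121 ∷ 3123 ∷ [])
    (leaf 𝟏 31 1 311) ∷
  node (13 ∷ 22 ∷ 32 ∷ 33 ∷ 211 ∷ 1121 ∷ 2121 ∷ [])
    (1123 ∷ 1212 ∷ 1231 ∷ 2123 ∷ 2311 ∷ 2312 ∷ 3112 ∷ 3121 ∷ 3123 ∷ [])
    (via rev (leaf 𝟏 113 13 1)) ∷
  node (13 ∷ 22 ∷ 32 ∷ 33 ∷ 211 ∷ [])
    (112 ∷ 121 ∷ 123 ∷ 212 ∷ 231 ∷ 311 ∷ 312 ∷ [])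
    (split 2121 (contra 2121) (split 1212 (split 1231 (split 2123 (split 2311 (split 2312 (split
      3112 (split 1121 (split 1123 (split 3121 (split 3123 (count 4) (case 3)) (split 3123 (case 2)
      (contra 123))) (split 3121 (split 3123 (case 1) (contra 123)) (contra 121))) (split 1123
      (split 3121 (split 3123 (case 0) (contra 123)) (contra 121)) (contra 112))) (contra 112))
      (contra 231)) (contra 231)) (contra 123)) (contra 123)) (contra 121))) ∷
  node (22 ∷ 23 ∷ 31 ∷ 33 ∷ [])
    (11 ∷ 12 ∷ 13 ∷ 21 ∷ 32 ∷ [])
    (split 121 (split 132 (split 211 (split 321 (split 112 (split 113 (split 212 (split 213 (count
      3) (case 10)) (split 213 (case 6) (contra 13))) (split 212 (split 213 (via rev (case 5))
      (contra 13)) (contra 12))) (split 113 (split 212 (split 213 (via rev (case 0)) (contra 13))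
      (contra 12)) (contra 11))) (contra 21)) (contra 11)) (contra 13)) (contra 12)) ∷
  node (13 ∷ 22 ∷ 31 ∷ 33 ∷ 323 ∷ 2121 ∷ 3212 ∷ [])
    (1121 ∷ 1123 ∷ 1211 ∷ 1212 ∷ 1232 ∷ 2112 ∷ 2123 ∷ 2321 ∷ 3211 ∷ [])
    (via rev (leaf 𝟎 232 0 2)) ∷
  node (13 ∷ 22 ∷ 31 ∷ 33 ∷ 323 ∷ 1212 ∷ 2121 ∷ 121121 ∷ 2123212 ∷ 112321123 ∷ 121123211 ∷ [])
    (112112321 ∷ 112321121 ∷ 112321232 ∷ 121123212 ∷ 123211211 ∷ 123211232 ∷ 123212321 ∷ 211211232 ∷
      211232112 ∷ 211232123 ∷ 212321121 ∷ 212321123 ∷ 232112112 ∷ 232112321 ∷ 232123211 ∷ 321121123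
      ∷ 321123211 ∷ 321123212 ∷ 321232112 ∷ [])
    (via rev (leaf 𝟐 2112112 212 2112)) ∷
  node (13 ∷ 22 ∷ 31 ∷ 33 ∷ 323 ∷ 1212 ∷ 2121 ∷ 121121 ∷ 2123212 ∷ [])
    (11211232 ∷ 11232112 ∷ 11232123 ∷ 12112321 ∷ 12321121 ∷ 12321123 ∷ 12321232 ∷ 21121123 ∷
      21123211 ∷ 21123212 ∷ 21232112 ∷ 23211211 ∷ 23211232 ∷ 23212321 ∷ 32112112 ∷ 32112321 ∷
      32123211 ∷ [])
    (split 112112321 (split 112321232 (split 123211211 (split 123211232 (split 123212321 (split
      211211232 (split 211232112 (split 211232123 (split 232112112 (split 232112321 (split 232123211
      (split 321121123 (split 321232112 (split 112321121 (split 112321123 (split 121123211 (split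
      121123212 (split 212321121 (split 212321123 (split 321123211 (count 9) (contra 112321121))
      (contra 112321121)) (split 212321123 (split 321123211 (split 321123212 (count 9) (contra
      11211232)) (contra 21123211)) (contra 12321123))) (split 212321121 (split 212321123 (split
      321123211 (split 321123212 (count 9) (contra 11211232)) (contra 21123211)) (contra 12321123))
      (contra 12321121))) (contra 112321123)) (split 121123211 (contra 121123211) (split 121123212
      (split 212321121 (split 212321123 (split 321123211 (split 321123212 (case 0) (contra
      21123212)) (contra 21123211)) (contra 12321123)) (contra 12321121)) (contra 12112321))))
      (split 321123211 (contra 321123211) (split 112321123 (split 121123211 (split 121123212 (split
      212321121 (split 212321123 (split 321123212 (via rev (case 0)) (contra 21123212)) (contra
      12321123)) (contra 12321121)) (contra 12112321)) (contra 12112321)) (contra 11232112))))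
      (contra 21232112)) (contra 21121123)) (contra 23212321)) (contra 23211232)) (contra 23211211))
      (contra 11232123)) (contra 11232112)) (contra 11211232)) (contra 12321232)) (contra 12321123))
      (contra 12321121)) (contra 11232123)) (contra 11211232)) ∷
  node (13 ∷ 22 ∷ 31 ∷ 33 ∷ 323 ∷ 1212 ∷ 2121 ∷ 121121 ∷ 2123212 ∷ [])
    (1121123 ∷ 1123211 ∷ 1123212 ∷ 1211232 ∷ 1232112 ∷ 1232123 ∷ 2112112 ∷ 2112321 ∷ 2123211 ∷
      2321121 ∷ 2321123 ∷ 2321232 ∷ 3211211 ∷ 3211232 ∷ 3212321 ∷ [])
    (split 11211232 (split 11232112 (split 11232123 (split 12112321 (split 12321121 (split 12321123
      (split 12321232 (split 21121123 (split 21123211 (split 21123212 (split 21232112 (split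
      23211211 (split 23211232 (split 23212321 (split 32112112 (split 32112321 (split 32123211 (case
      0) (contra 2123211)) (contra 2112321)) (contra 2112112)) (contra 2321232)) (contra 2321123))
      (contra 2321121)) (contra 1232112)) (contra 1123212)) (contra 1123211)) (contra 1121123))
      (contra 1232123)) (contra 1232112)) (contra 1232112)) (contra 1211232)) (contra 1123212))
      (contra 1123211)) (contra 1121123)) ∷
  node (13 ∷ 22 ∷ 31 ∷ 33 ∷ 323 ∷ 1212 ∷ 2121 ∷ 121121 ∷ [])
    (112112 ∷ 112321 ∷ 121123 ∷ 123211 ∷ 123212 ∷ 211211 ∷ 211232 ∷ 212321 ∷ 232112 ∷ 232123 ∷
      321121 ∷ 321123 ∷ 321232 ∷ [])
    (split 2123212 (contra 2123212) (split 1121123 (split 1123212 (split 1211232 (split 1232112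
      (split 1232123 (split 2112112 (split 2112321 (split 2123211 (split 2321121 (split 2321123
      (split 2321232 (split 3211211 (split 3211232 (split 3212321 (split 1123211 (case 0) (contra
      112112)) (contra 212321)) (contra 211232)) (contra 211211)) (contra 232123)) (contra 232112))
      (contra 232112)) (contra 123211)) (contra 112321)) (contra 112112)) (contra 123212)) (contra
      123211)) (contra 121123)) (contra 112321)) (contra 112112))) ∷
  node (13 ∷ 22 ∷ 31 ∷ 33 ∷ 323 ∷ 1212 ∷ 2121 ∷ [])
    (11211 ∷ 11232 ∷ 12112 ∷ 12321 ∷ 21121 ∷ 21123 ∷ 21232 ∷ 23211 ∷ 23212 ∷ 32112 ∷ 32123 ∷ [])
    (split 121121 (contra 121121) (split 112112 (split 112321 (split 121123 (split 123211 (split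
      123212 (split 211211 (split 211232 (split 212321 (split 232112 (split 232123 (split 321121
      (split 321123 (split 321232 (case 0) (contra 21232)) (contra 21123)) (contra 21121)) (contra
      23212)) (contra 23211)) (contra 12321)) (contra 11232)) (contra 11211)) (contra 12321))
      (contra 12321)) (contra 12112)) (contra 11232)) (contra 11211))) ∷
  node (13 ∷ 22 ∷ 31 ∷ 33 ∷ 323 ∷ 1212 ∷ 2121 ∷ [])
    (1121 ∷ 1123 ∷ 1211 ∷ 1232 ∷ 2112 ∷ 2123 ∷ 2321 ∷ 3211 ∷ 3212 ∷ [])
    (split 11211 (split 11232 (split 12112 (split 12321 (split 21121 (split 21123 (split 21232
      (split 23211 (split 23212 (split 32112 (split 32123 (case 0) (contra 2123)) (contra 2112))
      (contra 2321)) (contra 2321)) (contra 1232)) (contra 1123)) (contra 1121)) (contra 1232))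
      (contra 1211)) (contra 1123)) (contra 1121)) ∷
  node (13 ∷ 22 ∷ 31 ∷ 33 ∷ 323 ∷ 1211 ∷ 2121 ∷ [])
    (1121 ∷ 1123 ∷ 1212 ∷ 1232 ∷ 2112 ∷ 2123 ∷ 2321 ∷ 3211 ∷ 3212 ∷ [])
    (leaf 𝟏 11 3 1) ∷
  node (13 ∷ 22 ∷ 31 ∷ 33 ∷ 323 ∷ [])
    (112 ∷ 121 ∷ 123 ∷ 211 ∷ 212 ∷ 232 ∷ 321 ∷ [])
    (split 1232 (split 2112 (split 2321 (split 1121 (split 1123 (split 1211 (split 1212 (split 2123
      (split 2121 (split 3211 (count 4) (split 3212 (count 4) (contra 112))) (split 3211 (split 3212
      (count 4) (case 7)) (contra 211))) (contra 1212)) (split 3211 (split 3212 (split 2121 (split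
      2123 (count 4) (via rev (case 7))) (split 2123 (case 1) (contra 123))) (contra 212)) (contra
      211))) (split 2121 (contra 2121) (split 1212 (split 2123 (split 3211 (split 3212 (case 0)
      (contra 212)) (contra 211)) (contra 123)) (contra 121)))) (split 1211 (split 1212 (split 2121
      (split 2123 (split 3211 (split 3212 (count 4) (contra 112)) (contra 211)) (contra 123))
      (contra 121)) (contra 121)) (contra 121))) (split 1212 (contra 1212) (split 1123 (split 1211
      (split 2121 (split 2123 (split 3211 (split 3212 (via rev (case 0)) (contra 212)) (contra 211))
      (contra 123)) (contra 121)) (contra 121)) (contra 112)))) (contra 232)) (contra 112)) (contra
      123)) ∷
  node (13 ∷ 22 ∷ 31 ∷ 33 ∷ [])
    (11 ∷ 12 ∷ 21 ∷ 23 ∷ 32 ∷ [])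
    (split 323 (contra 323) (split 112 (split 121 (split 123 (split 211 (split 212 (split 232 (split
      321 (case 0) (contra 21)) (contra 23)) (contra 12)) (contra 11)) (contra 12)) (contra 12))
      (contra 11))) ∷
  node (13 ∷ 21 ∷ 32 ∷ 33 ∷ 3123 ∷ 22312 ∷ [])
    (11223 ∷ 11231 ∷ 12231 ∷ 12311 ∷ 12312 ∷ 22311 ∷ 23112 ∷ 23122 ∷ 31122 ∷ 31123 ∷ 31223 ∷ [])
    (via rev (leaf 𝟎 322 0 32)) ∷
  node (13 ∷ 21 ∷ 32 ∷ 33 ∷ 3123 ∷ 12312 ∷ [])
    (11223 ∷ 11231 ∷ 12231 ∷ 12311 ∷ 22311 ∷ 22312 ∷ 23112 ∷ 23122 ∷ 31122 ∷ 31123 ∷ 31223 ∷ [])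
    (leaf 𝟐 122 1122 112) ∷
  node (13 ∷ 21 ∷ 32 ∷ 33 ∷ 3123 ∷ [])
    (1122 ∷ 1123 ∷ 1223 ∷ 1231 ∷ 2231 ∷ 2311 ∷ 2312 ∷ 3112 ∷ 3122 ∷ [])
    (split 11223 (split 11231 (split 12231 (split 22311 (split 23112 (split 23122 (split 31122
      (split 31123 (split 31223 (split 12311 (split 12312 (split 22312 (count 5) (case 1)) (split
      22312 (case 0) (contra 2231))) (split 12312 (split 22312 (via rev (via σ₀₁ (case 1))) (contra
      2231)) (contra 1231))) (contra 1223)) (contra 1123)) (contra 1122)) (contra 2312)) (contra
      2311)) (contra 2231)) (contra 1223)) (contra 1123)) (contra 1122)) ∷
  node (13 ∷ 21 ∷ 32 ∷ 33 ∷ 3122 ∷ 22312 ∷ [])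
    (11223 ∷ 11231 ∷ 12231 ∷ 12311 ∷ 12312 ∷ 22311 ∷ 23112 ∷ 23123 ∷ 31122 ∷ 31123 ∷ 31231 ∷ [])
    (via rev (leaf 𝟐 2211 211 21)) ∷
  node (13 ∷ 21 ∷ 32 ∷ 33 ∷ 3122 ∷ [])
    (1122 ∷ 1123 ∷ 1223 ∷ 1231 ∷ 2231 ∷ 2311 ∷ 2312 ∷ 3112 ∷ 3123 ∷ [])
    (split 11223 (split 11231 (split 12231 (split 12311 (split 22311 (split 23112 (split 23123
      (split 31122 (split 31123 (split 31231 (split 12312 (split 22312 (count 5) (case 0)) (contra
      22311)) (contra 1231)) (contra 1123)) (contra 1122)) (contra 2312)) (contra 2311)) (contra
      2231)) (contra 1231)) (contra 1223)) (contra 1123)) (contra 1122)) ∷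
  node (13 ∷ 21 ∷ 32 ∷ 33 ∷ 1122 ∷ 22311 ∷ [])
    (11231 ∷ 12231 ∷ 12311 ∷ 12312 ∷ 22312 ∷ 23112 ∷ 23122 ∷ 23123 ∷ 31123 ∷ 31223 ∷ 31231 ∷ [])
    (leaf 𝟎 0 23 223) ∷
  node (13 ∷ 21 ∷ 32 ∷ 33 ∷ 1122 ∷ [])
    (1123 ∷ 1223 ∷ 1231 ∷ 2231 ∷ 2311 ∷ 2312 ∷ 3112 ∷ 3122 ∷ 3123 ∷ [])
    (split 11231 (split 12231 (split 12311 (split 12312 (split 22312 (split 23112 (split 23122
      (split 23123 (split 31123 (split 31223 (split 31231 (split 22311 (count 5) (case 0)) (contra
      1231)) (contra 1223)) (contra 1123)) (contra 2312)) (contra 2312)) (contra 2311)) (contra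
      2231)) (contra 1231)) (contra 2311)) (contra 1223)) (contra 1123)) ∷
  node (13 ∷ 21 ∷ 32 ∷ 33 ∷ [])
    (112 ∷ 122 ∷ 123 ∷ 223 ∷ 231 ∷ 311 ∷ 312 ∷ [])
    (split 1223 (split 1231 (split 2231 (split 2311 (split 2312 (split 3112 (split 1122 (split 1123
      (split 3122 (split 3123 (count 4) (case 4)) (split 3123 (case 2) (contra 123))) (split 3122
      (split 3123 (via rev (via σ₀₁ (case 2))) (contra 123)) (contra 122))) (split 1123 (split 3122
      (split 3123 (case 0) (contra 123)) (contra 122)) (contra 112))) (contra 112)) (contra 231))
      (contra 231)) (contra 223)) (contra 123)) (contra 122)) ∷
  node (13 ∷ 21 ∷ 32 ∷ 33 ∷ [])
    (11 ∷ 12 ∷ 22 ∷ 23 ∷ 31 ∷ [])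
    (split 112 (split 122 (split 123 (split 223 (split 231 (split 311 (split 312 (case 0) (contra
      12)) (contra 11)) (contra 23)) (contra 22)) (contra 12)) (contra 12)) (contra 11)) ∷
  node (13 ∷ 21 ∷ 22 ∷ 33 ∷ 3232 ∷ 12311 ∷ 31231 ∷ [])
    (11231 ∷ 11232 ∷ 12312 ∷ 12323 ∷ 23112 ∷ 23123 ∷ 23231 ∷ 31123 ∷ 31232 ∷ 32311 ∷ 32312 ∷ [])
    (leaf 𝟐 112 2 12) ∷
  node (13 ∷ 21 ∷ 22 ∷ 33 ∷ 3232 ∷ [])
    (1123 ∷ 1231 ∷ 1232 ∷ 2311 ∷ 2312 ∷ 2323 ∷ 3112 ∷ 3123 ∷ 3231 ∷ [])
    (split 12323 (split 23112 (split 23123 (split 23231 (split 31123 (split 11231 (split 12312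
      (split 11232 (split 12311 (split 31231 (split 31232 (split 32311 (count 5) (split 32312 (count
      5) (contra 1123))) (split 32311 (split 32312 (count 5) (contra 1232)) (contra 3231))) (contra
      12311)) (split 31231 (contra 31231) (split 31232 (split 32311 (split 32312 (case 0) (contra
      2312)) (contra 2311)) (contra 1232)))) (split 12311 (split 31231 (split 31232 (split 32311
      (split 32312 (count 5) (contra 1232)) (contra 2311)) (contra 1232)) (contra 1231)) (contra
      1231))) (contra 11231)) (split 12312 (contra 12312) (split 11232 (split 12311 (split 31231
      (split 31232 (split 32311 (split 32312 (via rev (via σ₁₂ (case 0))) (contra 2312)) (contra
      2311)) (contra 1232)) (contra 1231)) (contra 1231)) (contra 1123)))) (contra 1123)) (contra
      2323)) (contra 2312)) (contra 2311)) (contra 1232)) ∷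
  node (13 ∷ 21 ∷ 22 ∷ 33 ∷ [])
    (112 ∷ 123 ∷ 231 ∷ 232 ∷ 311 ∷ 312 ∷ 323 ∷ [])
    (split 3232 (contra 3232) (split 1123 (split 1231 (split 1232 (split 2311 (split 2312 (split
      2323 (split 3112 (split 3123 (split 3231 (case 0) (contra 231)) (contra 123)) (contra 112))
      (contra 232)) (contra 231)) (contra 231)) (contra 123)) (contra 123)) (contra 112))) ∷
  node (13 ∷ 21 ∷ 22 ∷ 33 ∷ [])
    (11 ∷ 12 ∷ 23 ∷ 31 ∷ 32 ∷ [])
    (split 112 (split 123 (split 231 (split 232 (split 311 (split 312 (split 323 (case 0) (contra
      23)) (contra 12)) (contra 11)) (contra 23)) (contra 23)) (contra 12)) (contra 11)) ∷
  node (11 ∷ 22 ∷ 32 ∷ 33 ∷ 313 ∷ [])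
    (121 ∷ 123 ∷ 131 ∷ 212 ∷ 213 ∷ 231 ∷ 312 ∷ [])
    (via rev (leaf 𝟎 32 2 3)) ∷
  node (11 ∷ 22 ∷ 32 ∷ 33 ∷ 213 ∷ 1313 ∷ 2121 ∷ 23121 ∷ [])
    (12123 ∷ 12312 ∷ 12313 ∷ 13121 ∷ 13123 ∷ 21231 ∷ 23123 ∷ 23131 ∷ 31212 ∷ 31231 ∷ 31312 ∷ [])
    (via rev (leaf 𝟐 21 1 2121)) ∷
  node (11 ∷ 13 ∷ 22 ∷ 33 ∷ 321 ∷ 2121 ∷ 3232 ∷ 31231 ∷ 323123 ∷ [])
    (121231 ∷ 121232 ∷ 123121 ∷ 123123 ∷ 123231 ∷ 212312 ∷ 212323 ∷ 231212 ∷ 231232 ∷ 232312 ∷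
      312123 ∷ 312323 ∷ 323121 ∷ [])
    (leaf 𝟏 1 31 3) ∷
  node (11 ∷ 22 ∷ 32 ∷ 33 ∷ 213 ∷ 1313 ∷ 2121 ∷ 23123 ∷ 312312 ∷ 231212312 ∷ 312313123 ∷ [])
    (12123121231 ∷ 12123131212 ∷ 12123131231 ∷ 12312123131 ∷ 12313121231 ∷ 12313123131 ∷ 13121231212
      ∷ 13121231312 ∷ 13123131212 ∷ 21231212313 ∷ 21231312123 ∷ 21231312313 ∷ 23121231312 ∷
      23131212312 ∷ 23131212313 ∷ 23131231312 ∷ 31212312123 ∷ 31212313121 ∷ 31212313123 ∷
      31231312123 ∷ 31312123121 ∷ 31312123131 ∷ 31312313121 ∷ [])
    (split 131212313121 (contra 131212313121) (split 231212313123 (contra 231212313123) (contra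
      13121231212))) ∷
  node (11 ∷ 22 ∷ 32 ∷ 33 ∷ 213 ∷ 1313 ∷ 2121 ∷ 23123 ∷ 312312 ∷ 231212312 ∷ 312313123 ∷ [])
    (1212312123 ∷ 1212313121 ∷ 1212313123 ∷ 1231212313 ∷ 1231312123 ∷ 1231312313 ∷ 1312123121 ∷
      1312123131 ∷ 1312313121 ∷ 2123121231 ∷ 2123131212 ∷ 2123131231 ∷ 2312123131 ∷ 2313121231 ∷
      2313123131 ∷ 3121231212 ∷ 3121231312 ∷ 3123131212 ∷ 3131212312 ∷ 3131212313 ∷ 3131231312 ∷ [])
    (split 12123121231 (split 12123131212 (split 12123131231 (split 12312123131 (split 12313121231
      (split 12313123131 (split 13121231212 (split 13121231312 (split 13123131212 (split 21231212313
      (split 21231312123 (split 21231312313 (split 23121231312 (split 23131212312 (split 23131212313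
      (split 23131231312 (split 31212312123 (split 31212313121 (split 31212313123 (split 31231312123
      (split 31312123121 (split 31312123131 (split 31312313121 (case 0) (contra 1312313121)) (contra
      1312123131)) (contra 1312123121)) (contra 1231312123)) (contra 1212313123)) (contra
      1212313121)) (contra 1212312123)) (contra 2313123131)) (contra 2313121231)) (contra
      2313121231)) (contra 2312123131)) (contra 1231312313)) (contra 1231312123)) (contra
      1231212313)) (contra 1312313121)) (contra 1312123131)) (contra 1312123121)) (contra
      1231312313)) (contra 1231312123)) (contra 1231212313)) (contra 1212313123)) (contra
      1212313121)) (contra 1212312123)) ∷
  node (11 ∷ 22 ∷ 32 ∷ 33 ∷ 213 ∷ 1313 ∷ 2121 ∷ 23123 ∷ 312312 ∷ 231212312 ∷ 312313123 ∷ [])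
    (121231212 ∷ 121231312 ∷ 123121231 ∷ 123131212 ∷ 123131231 ∷ 131212312 ∷ 131212313 ∷ 131231312 ∷
      212312123 ∷ 212313121 ∷ 212313123 ∷ 231212313 ∷ 231312123 ∷ 231312313 ∷ 312123121 ∷ 312123131
      ∷ 312313121 ∷ 313121231 ∷ 313123131 ∷ [])
    (split 1212312123 (split 1212313121 (split 1212313123 (split 1231212313 (split 1231312123 (split
      1231312313 (split 1312123121 (split 1312123131 (split 1312313121 (split 2123121231 (split
      2123131212 (split 2123131231 (split 2312123131 (split 2313121231 (split 2313123131 (split
      3121231212 (split 3121231312 (split 3123131212 (split 3131212312 (split 3131212313 (split
      3131231312 (case 0) (contra 131231312)) (contra 131212313)) (contra 131212312)) (contra
      123131212)) (contra 121231312)) (contra 121231212)) (contra 231312313)) (contra 231312123))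
      (contra 231212313)) (contra 123131231)) (contra 123131212)) (contra 123121231)) (contra
      131231312)) (contra 131212313)) (contra 131212312)) (contra 123131231)) (contra 123131212))
      (contra 123121231)) (contra 121231312)) (contra 121231312)) (contra 121231212)) ∷
  node (11 ∷ 22 ∷ 32 ∷ 33 ∷ 213 ∷ 1313 ∷ 2121 ∷ 23123 ∷ 312312 ∷ [])
    (12123121 ∷ 12123131 ∷ 12312123 ∷ 12313121 ∷ 12313123 ∷ 13121231 ∷ 13123131 ∷ 21231212 ∷
      21231312 ∷ 23121231 ∷ 23131212 ∷ 23131231 ∷ 31212312 ∷ 31212313 ∷ 31231312 ∷ 31312123 ∷
      31312313 ∷ [])
    (split 231212312 (contra 231212312) (split 312313123 (contra 312313123) (split 121231212 (split
      121231312 (split 123121231 (split 123131212 (split 123131231 (split 131212312 (split 131212313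
      (split 131231312 (split 212312123 (split 212313121 (split 212313123 (split 231212313 (split
      231312123 (split 231312313 (split 312123121 (split 312123131 (split 312313121 (split 313121231
      (split 313123131 (case 0) (contra 13123131)) (contra 13121231)) (contra 12313121)) (contra
      12123131)) (contra 12123121)) (contra 23131231)) (contra 23131212)) (contra 23121231)) (contra
      12313123)) (contra 12313121)) (contra 12312123)) (contra 13123131)) (contra 13121231)) (contra
      13121231)) (contra 12313123)) (contra 12313121)) (contra 12312123)) (contra 12123131)) (contra
      12123121)))) ∷
  node (11 ∷ 22 ∷ 32 ∷ 33 ∷ 213 ∷ 1313 ∷ 2121 ∷ 23123 ∷ 312312 ∷ [])
    (1212312 ∷ 1212313 ∷ 1231212 ∷ 1231312 ∷ 1312123 ∷ 1312313 ∷ 2123121 ∷ 2123131 ∷ 2312123 ∷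
      2313121 ∷ 2313123 ∷ 3121231 ∷ 3123131 ∷ 3131212 ∷ 3131231 ∷ [])
    (split 12123121 (split 12123131 (split 12312123 (split 12313121 (split 12313123 (split 13121231
      (split 13123131 (split 21231212 (split 21231312 (split 23121231 (split 23131212 (split
      23131231 (split 31212312 (split 31212313 (split 31231312 (split 31312123 (split 31312313 (case
      0) (contra 1312313)) (contra 1312123)) (contra 1231312)) (contra 1212313)) (contra 1212312))
      (contra 2313123)) (contra 2313121)) (contra 2312123)) (contra 1231312)) (contra 1231212))
      (contra 1312313)) (contra 1312123)) (contra 1231312)) (contra 1231312)) (contra 1231212))
      (contra 1212313)) (contra 1212312)) ∷
  node (11 ∷ 13 ∷ 22 ∷ 33 ∷ 321 ∷ 2121 ∷ 3232 ∷ 31231 ∷ 123123 ∷ [])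
    (121231 ∷ 121232 ∷ 123121 ∷ 123231 ∷ 212312 ∷ 212323 ∷ 231212 ∷ 231232 ∷ 232312 ∷ 312123 ∷
      312323 ∷ 323121 ∷ 323123 ∷ [])
    (split 1212312 (split 1212323 (split 1231212 (split 1232312 (split 2123121 (split 2123231 (split
      2312123 (split 2312323 (split 2323121 (split 2323123 (split 3121231 (split 3121232 (split
      3123231 (split 3231212 (split 3231232 (via rev (via σ₀₁ (case 0))) (contra 231232)) (contra
      231212)) (contra 123231)) (contra 121232)) (contra 121231)) (contra 232312)) (contra 232312))
      (contra 231232)) (contra 231212)) (contra 123231)) (contra 123121)) (contra 123231)) (contra
      123121)) (contra 121232)) (contra 121231)) ∷
  node (11 ∷ 22 ∷ 32 ∷ 33 ∷ 213 ∷ 1313 ∷ 2121 ∷ 23123 ∷ [])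
    (12123 ∷ 12312 ∷ 12313 ∷ 13121 ∷ 13123 ∷ 21231 ∷ 23121 ∷ 23131 ∷ 31212 ∷ 31231 ∷ 31312 ∷ [])
    (split 121231 (split 123121 (split 123131 (split 131212 (split 131231 (split 212313 (split
      231212 (split 231312 (split 312123 (split 313121 (split 313123 (split 212312 (split 312312
      (split 312313 (count 6) (via rev (via σ₀₁ (case 6)))) (split 312313 (via rev (via σ₀₁ (case 0)))
      (contra 12313))) (split 312312 (split 312313 (via σ₁₂ (via σ₀₁ (case 6))) (contra 31231))
      (contra 12312))) (contra 13123)) (contra 13121)) (contra 12123)) (contra 23131)) (contra
      23121)) (contra 12313)) (contra 13123)) (contra 13121)) (contra 12313)) (contra 12312))
      (contra 12123)) ∷
  node (11 ∷ 22 ∷ 32 ∷ 33 ∷ 213 ∷ 1313 ∷ 2121 ∷ 13121 ∷ [])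
    (12123 ∷ 12312 ∷ 12313 ∷ 13123 ∷ 21231 ∷ 23121 ∷ 23123 ∷ 23131 ∷ 31212 ∷ 31231 ∷ 31312 ∷ [])
    (leaf 𝟏 1 31 3131) ∷
  node (11 ∷ 13 ∷ 22 ∷ 33 ∷ 321 ∷ 2121 ∷ 3232 ∷ [])
    (1212 ∷ 1231 ∷ 1232 ∷ 2123 ∷ 2312 ∷ 2323 ∷ 3121 ∷ 3123 ∷ 3231 ∷ [])
    (split 12123 (split 12312 (split 12323 (split 23121 (split 23123 (split 23231 (split 31212
      (split 32312 (split 21231 (split 21232 (split 31231 (split 31232 (count 5) (via σ₀₁ (via σ₁₂
      (case 9)))) (split 31232 (via rev (via σ₀₁ (case 1))) (contra 1232))) (split 31231 (split 31232
      (via rev (via σ₀₁ (case 0))) (contra 1232)) (contra 1231))) (split 21232 (split 31231 (split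
      31232 (via rev (via σ₀₁ (case 9))) (contra 1232)) (contra 1231)) (contra 1232))) (contra 2312))
      (contra 1212)) (contra 2323)) (contra 2312)) (contra 2312)) (contra 1232)) (contra 1231))
      (contra 1212)) ∷
  node (11 ∷ 22 ∷ 32 ∷ 33 ∷ 213 ∷ [])
    (121 ∷ 123 ∷ 131 ∷ 212 ∷ 231 ∷ 312 ∷ 313 ∷ [])
    (split 1313 (contra 1313) (split 2121 (contra 2121) (split 1212 (split 1231 (split 1312 (split
      2123 (split 2312 (split 2313 (split 3121 (split 3123 (split 3131 (via rev (via σ₀₁ (case 0)))
      (contra 131)) (contra 123)) (contra 121)) (contra 231)) (contra 231)) (contra 123)) (contra
      131)) (contra 123)) (contra 121)))) ∷
  node (11 ∷ 22 ∷ 32 ∷ 33 ∷ [])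
    (12 ∷ 13 ∷ 21 ∷ 23 ∷ 31 ∷ [])
    (split 121 (split 123 (split 131 (split 231 (split 312 (split 212 (split 213 (split 313 (count
      3) (case 12)) (split 313 (case 0) (contra 13))) (split 213 (split 313 (via rev (via σ₁₂ (case
      12))) (contra 13)) (contra 13))) (contra 12)) (contra 23)) (contra 13)) (contra 12)) (contra
      12)) ∷
  node ([])
    (1 ∷ 2 ∷ 3 ∷ [])
    (split 11 (split 12 (split 13 (split 21 (split 22 (split 23 (count 2) (split 31 (count 2) (split
      32 (count 2) (contra 3)))) (split 23 (split 31 (count 2) (split 32 (count 2) (contra 1)))
      (split 31 (split 32 (count 2) (split 33 (count 2) (case 49))) (split 32 (split 33 (count 2)
      (case 37)) (contra 2))))) (split 23 (split 31 (split 22 (count 2) (split 32 (count 2) (split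
      33 (count 2) (via σ₁₂ (case 37))))) (contra 1)) (contra 2))) (split 23 (split 21 (split 22
      (split 31 (count 2) (split 32 (count 2) (contra 3))) (split 31 (split 32 (count 2) (split 33
      (count 2) (via rev (case 37)))) (split 32 (split 33 (count 2) (case 27)) (contra 2)))) (split
      31 (split 22 (split 32 (count 2) (split 33 (count 2) (case 18))) (split 32 (split 33 (count 2)
      (case 14)) (split 33 (via rev (via σ₁₂ (case 18))) (contra 3)))) (contra 1))) (contra 3)))
      (split 13 (split 32 (split 21 (split 22 (split 23 (count 2) (split 31 (count 2) (split 33
      (count 2) (via rev (case 18))))) (split 23 (split 31 (count 2) (split 33 (count 2) (via rev
      (case 14)))) (split 31 (split 33 (count 2) (via rev (via σ₁₂ (case 37)))) (split 33 (via σ₁₂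
      (case 18)) (contra 3))))) (split 23 (split 31 (split 22 (count 2) (split 33 (count 2) (via σ₁₂
      (case 27)))) (contra 1)) (contra 2))) (contra 2)) (contra 1))) (split 12 (split 13 (split 21
      (split 22 (split 23 (split 31 (count 2) (split 32 (count 2) (contra 1))) (split 31 (split 32
      (count 2) (split 33 (count 2) (via σ₀₁ (case 27)))) (split 32 (split 33 (count 2) (via rev (via
      σ₀₁ (case 37)))) (contra 2)))) (split 23 (split 31 (split 32 (count 2) (split 33 (count 2)
      (case 0))) (split 32 (split 33 (count 2) (via σ₀₁ (case 0))) (contra 2))) (split 31 (split 32
      (split 33 (count 2) (via rev (case 0))) (split 33 (via σ₁₂ (via σ₀₁ (case 27))) (contra 3)))
      (split 32 (split 33 (via rev (via σ₁₂ (via σ₀₁ (case 14)))) (contra 3)) (contra 2))))) (split 23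
      (split 31 (split 22 (split 32 (count 2) (split 33 (count 2) (via rev (via σ₀₁ (case 14)))))
      (split 32 (split 33 (count 2) (via σ₁₂ (via σ₀₁ (case 0)))) (split 33 (via rev (via σ₁₂ (via σ₀₁
      (case 37)))) (contra 3)))) (contra 1)) (contra 2))) (split 23 (split 21 (split 22 (split 31
      (split 32 (count 2) (split 33 (count 2) (via σ₀₁ (case 37)))) (split 32 (split 33 (count 2)
      (via σ₀₁ (case 49))) (contra 2))) (split 31 (split 32 (split 33 (count 2) (via rev (via σ₀₁
      (case 0)))) (split 33 (via σ₁₂ (via σ₀₁ (case 14))) (contra 3))) (split 32 (split 33 (via σ₀₁
      (via σ₁₂ (via σ₀₁ (case 27)))) (contra 3)) (contra 2)))) (split 31 (split 22 (split 32 (split 33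
      (count 2) (via rev (via σ₀₁ (via σ₁₂ (case 37))))) (split 33 (via σ₀₁ (via σ₁₂ (case 18))) (contra
      3))) (split 32 (split 33 (via σ₀₁ (via σ₁₂ (via σ₀₁ (case 37)))) (contra 3)) (contra 2))) (contra
      1))) (contra 2))) (split 13 (split 32 (split 21 (split 22 (split 23 (split 31 (count 2) (split
      33 (count 2) (via σ₀₁ (via σ₁₂ (case 37))))) (split 31 (split 33 (count 2) (via σ₀₁ (case 14)))
      (split 33 (via rev (via σ₀₁ (via σ₁₂ (case 18)))) (contra 3)))) (split 23 (split 31 (split 33
      (count 2) (via rev (via σ₁₂ (via σ₀₁ (case 0))))) (split 33 (via rev (via σ₀₁ (via σ₁₂ (via σ₀₁
      (case 37))))) (contra 3))) (split 31 (split 33 (via σ₁₂ (via σ₀₁ (case 37))) (contra 3)) (contra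
      1)))) (split 23 (split 31 (split 22 (split 33 (count 2) (via σ₀₁ (via σ₁₂ (case 27)))) (split 33
      (via σ₁₂ (via σ₀₁ (case 49))) (contra 3))) (contra 1)) (contra 2))) (contra 2)) (contra 1)))) ∷
  node (3 ∷ 2121 ∷ [])
    (1121 ∷ 1122 ∷ 1211 ∷ 1212 ∷ 1221 ∷ 2112 ∷ 2122 ∷ 2211 ∷ 2212 ∷ [])
    (split 11211 (split 11212 (split 11221 (split 12112 (split 12122 (split 12211 (split 12212
      (split 21121 (split 21122 (split 21221 (split 22112 (split 22122 (count 5) (contra 1122))
      (contra 2112)) (contra 1221)) (contra 1122)) (contra 1121)) (contra 2212)) (contra 1221))
      (contra 1212)) (contra 1211)) (contra 1122)) (contra 1121)) (contra 1121)) ∷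
  node (3 ∷ [])
    (112 ∷ 121 ∷ 122 ∷ 211 ∷ 212 ∷ 221 ∷ [])
    (split 1121 (split 1211 (split 1221 (split 2112 (split 2122 (split 2212 (split 1122 (split 1212
      (split 2121 (split 2211 (count 4) (contra 1121)) (split 2211 (case 0) (contra 211))) (split
      2121 (split 2211 (via rev (case 0)) (contra 211)) (contra 121))) (contra 1211)) (contra 212))
      (contra 212)) (contra 112)) (contra 122)) (contra 121)) (contra 121)) ∷
  node (3 ∷ [])
    (11 ∷ 12 ∷ 21 ∷ 22 ∷ [])
    (split 112 (split 121 (split 122 (split 211 (split 212 (split 221 (case 0) (contra 21)) (contra
      12)) (contra 11)) (contra 12)) (contra 12)) (contra 11)) ∷
  node (3 ∷ [])
    (1 ∷ 2 ∷ [])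
    (split 11 (split 12 (split 21 (split 22 (case 0) (contra 2)) (contra 1)) (contra 1)) (contra 1))
      ∷
  []

-- Distinguishes which letters occur. At `contra 0` at least two of them are absent, and powers of a
-- single letter are large repetitions.
root : Tree
root =
  split 1 (split 2 (split 3 (case 4) (case 0)) (split 3 (via σ₁₂ (case 0)) (contra 0))) (split 2
    (split 3 (via σ₀₁ (via σ₁₂ (case 0))) (contra 0)) (contra 0))

-- Depth 60 limits the extensions tried by `kill`. Width 8 suffices for the longest block, of seven
-- letters, and the `f` in front of it.
cases-valid : Checker.checkAll 60 8 long [] cases root ≡ true
cases-valid = refl

-- The test `heavy` is independent of the weights, so this one evaluation serves every decoding.
φ-derivable : Derivation.derivable 60 8 heavy forbidden 𝟎 φ ≡ true
φ-derivable = refl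

-- Starts the induction of `repetition-occurs`, as `lt 0 ∷ 𝔸 0 ++ 𝕋 0` is 01.
ab-occurs : Search.dead 60 heavy ((𝟎 ∷ 𝟏 ∷ []) ∷ forbidden) [] ≡ true
ab-occurs = refl

-- Growth of the repetitions

-- the weights of 𝔸 k and 𝕋 k below when 𝟎, 𝟏, 𝟐 weigh x, y, z

α : ℕ → ℕ → ℕ → ℕ → ℕ
α zero x y z = y
α (suc k) x y z = α k ((x + y) + (y + z)) ((y + z) + x) (x + y)

τ : ℕ → ℕ → ℕ → ℕ → ℕ
τ zero x y z = 0
τ (suc k) x y z = α 1 x y z + τ k ((x + y) + (y + z)) ((y + z) + x) (x + y)

-- The hypotheses say that m / d with m = d + e is an upper bound of λ, f / d³ being the value
-- of the polynomial at m / d, and that r / s ≤ 1 / ((m / d)² - 1).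

module Growth (d e f r s : ℕ) (d≥1 : 1 ≤ d) (f≥1 : 1 ≤ f) (r≥1 : 1 ≤ r) (s≥1 : 1 ≤ s)
  (f≡ : f + d * d * d ≡ (d + e) * e * e)
  (m²r≤d²g : (d + e) * (d + e) * r ≤ d * d * (r + s)) where

  m g : ℕ
  m = d + e
  g = r + s

  -- for m / d = λ this would be an eigenvector of the step (x, y, z) ↦ (x + y, y + z, x)
  V : ℕ → ℕ → ℕ → ℕ
  V x y z = d * d * x + m * e * y + e * d * z

  -- The eigenvector equation is exact in `x` and `z`. In `y` it is off by `f`, because `m / d` lies
  -- above the root; this defect makes `V` grow more slowly than the powers of `m / d`.
  V-step : ∀ x y z → d * V (x + y) (y + z) x + f * y ≡ m * V x y z
  V-step x y z = trans (lhs d e f x y z)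
    (trans (cong (λ w → d * (d * d * x + (d + e) * e * (y + z) + e * d * x) + w * y) f≡) (rhs d e x y z))
    where
    lhs : ∀ d e f x y z → d * (d * d * (x + y) + (d + e) * e * (y + z) + e * d * x) + f * y
                        ≡ d * (d * d * x + (d + e) * e * (y + z) + e * d * x) + (f + d * d * d) * y
    lhs = solve-∀
    rhs : ∀ d e x y z → d * (d * d * x + (d + e) * e * (y + z) + e * d * x) + (d + e) * e * e * y
                      ≡ (d + e) * (d * d * x + (d + e) * e * y + e * d * z)
    rhs = solve-∀

  -- Two steps of h make one decoding. Only the defect of the first step is kept.
  V-steps : ∀ x y z → d * d * V ((x + y) + (y + z)) ((y + z) + x) (x + y) + m * (f * y) ≤ m * m * V x y z
  V-steps x y z = begin
    d * d * V₂ + m * (f * y)   ≡⟨ cong (_+ m * (f * y)) (*-assoc d d V₂) ⟩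
    d * (d * V₂) + m * (f * y) ≤⟨ +-monoˡ-≤ _ (*-monoʳ-≤ d (≤-trans (m≤m+n _ _) (≤-reflexive (V-step (x + y) (y + z) x)))) ⟩
    d * (m * V₁) + m * (f * y) ≡⟨ regroup d m V₁ (f * y) ⟩
    m * (d * V₁ + f * y)       ≡⟨ cong (m *_) (V-step x y z) ⟩
    m * (m * V x y z)          ≡⟨ *-assoc m m _ ⟨
    m * m * V x y z            ∎
    where
    open ≤-Reasoning
    V₁ = V (x + y) (y + z) x
    V₂ = V ((x + y) + (y + z)) ((y + z) + x) (x + y)
    regroup : ∀ d m v w → d * (m * v) + m * w ≡ m * (d * v + w)
    regroup = solve-∀

  -- While no repetition is long enough, t grows by the factor (m / d)² at least, which V cannot keep up with.
  descend : ∀ x y z t j → 1 ≤ x →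
    s * t ≤ g * y → s * (t + ((y + z) + x)) ≤ g * ((y + z) + x) →
    m * g * V x y z ≤ suc j * t →
    m * g * V ((x + y) + (y + z)) ((y + z) + x) (x + y) ≤ j * (t + ((y + z) + x))
  descend x y z t j x≥1 st≤gy st′≤gy′ EV≤ = *-cancelˡ-≤ (d * d) {{d²≢0}} (begin
    d * d * (m * g * V₂)       ≤⟨ +-cancelʳ-≤ (m * m * t) _ _ step ⟩
    j * (m * m * t)            ≤⟨ *-monoʳ-≤ j m²t≤d²t′ ⟩
    j * (d * d * t′)           ≡⟨ swap j (d * d) t′ ⟩
    d * d * (j * t′)           ∎)
    where
    open ≤-Reasoning
    y′ = (y + z) + x
    t′ = t + y′
    V₂ = V ((x + y) + (y + z)) y′ (x + y)
    d²≢0 = >-nonZero (*-mono-≤ d≥1 d≥1)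
    swap : ∀ j d t → j * (d * t) ≡ d * (j * t)
    swap = solve-∀
    -- As `y′` is the increase from `t` to `t′`, the second failure bounds `t` by `(r / g) t′`, and
    -- `r / g ≤ (d / m)²`.
    gt≤rt′ : g * t ≤ r * t′
    gt≤rt′ = +-cancelʳ-≤ (s * t′) _ _ (begin
      g * t + s * t′   ≤⟨ +-monoʳ-≤ (g * t) st′≤gy′ ⟩
      g * t + g * y′   ≡⟨ *-distribˡ-+ g t y′ ⟨
      g * t′           ≡⟨ *-distribʳ-+ t′ r s ⟩
      r * t′ + s * t′  ∎)
    m²t≤d²t′ : m * m * t ≤ d * d * t′
    m²t≤d²t′ = *-cancelˡ-≤ r {{>-nonZero r≥1}} (begin
      r * (m * m * t)    ≡⟨ e₁ r (m * m) t ⟩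
      m * m * r * t      ≤⟨ *-monoˡ-≤ t m²r≤d²g ⟩
      d * d * g * t      ≡⟨ *-assoc (d * d) g t ⟩
      d * d * (g * t)    ≤⟨ *-monoʳ-≤ (d * d) gt≤rt′ ⟩
      d * d * (r * t′)   ≡⟨ swap (d * d) r t′ ⟩
      r * (d * d * t′)   ∎)
      where
      e₁ : ∀ r m t → r * (m * t) ≡ m * r * t
      e₁ = solve-∀
    -- The first failure bounds `t` by a multiple of `y`, so the defect `m f y`, scaled by `m * g`,
    -- pays for one unit of the counter `j`.
    m²t≤ : m * m * t ≤ m * g * (m * (f * y))
    m²t≤ = begin
      m * m * t              ≤⟨ *-monoʳ-≤ (m * m) (begin
        t                      ≡⟨ *-identityˡ t ⟨
        1 * t                  ≤⟨ *-monoˡ-≤ t s≥1 ⟩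
        s * t                  ≤⟨ st≤gy ⟩
        g * y                  ≡⟨ *-identityˡ (g * y) ⟨
        1 * (g * y)            ≤⟨ *-monoˡ-≤ (g * y) f≥1 ⟩
        f * (g * y)            ∎) ⟩
      m * m * (f * (g * y))  ≡⟨ e₂ m f g y ⟩
      m * g * (m * (f * y))  ∎
      where
      e₂ : ∀ m f g y → m * m * (f * (g * y)) ≡ m * g * (m * (f * y))
      e₂ = solve-∀
    step : d * d * (m * g * V₂) + m * m * t ≤ j * (m * m * t) + m * m * t
    step = begin
      d * d * (m * g * V₂) + m * m * t                  ≤⟨ +-monoʳ-≤ _ m²t≤ ⟩
      d * d * (m * g * V₂) + m * g * (m * (f * y))      ≡⟨ e₃ (d * d) (m * g) V₂ (m * (f * y)) ⟩
      m * g * (d * d * V₂ + m * (f * y))                ≤⟨ *-monoʳ-≤ (m * g) (V-steps x y z) ⟩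
      m * g * (m * m * V x y z)                         ≡⟨ swap (m * g) (m * m) _ ⟩
      m * m * (m * g * V x y z)                         ≤⟨ *-monoʳ-≤ (m * m) EV≤ ⟩
      m * m * (suc j * t)                               ≡⟨ e₄ (m * m) j t ⟩
      j * (m * m * t) + m * m * t                       ∎
      where
      e₃ : ∀ a b v w → a * (b * v) + b * w ≡ b * (a * v + w)
      e₃ = solve-∀
      e₄ : ∀ m j t → m * (suc j * t) ≡ j * (m * t) + m * t
      e₄ = solve-∀

  m≥1 : 1 ≤ m
  m≥1 = ≤-trans d≥1 (m≤m+n d e)

  V≥1 : ∀ x y z → 1 ≤ x → 1 ≤ m * g * V x y z
  V≥1 x y z x≥1 = *-mono-≤ (*-mono-≤ m≥1 (≤-trans r≥1 (m≤m+n r s)))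
    (≤-trans (*-mono-≤ (*-mono-≤ d≥1 d≥1) x≥1) (≤-trans (m≤m+n _ _) (m≤m+n _ _)))

  -- Replaces the passage to the limit: `j` bounds the ratio of `m g V` to `t`, which drops by at
  -- least one per decoding and cannot reach 0 as `V` is positive.
  exceeds-from : ∀ j x y z t → 1 ≤ x → m * g * V x y z ≤ j * t → ∃ λ k → g * α k x y z < s * (t + τ k x y z)
  exceeds-from zero x y z t x≥1 EV≤ = ⊥-elim (<⇒≱ (V≥1 x y z x≥1) EV≤)
  -- The descent needs two consecutive failures, although a round advances by one decoding only.
  exceeds-from (suc j) x y z t x≥1 EV≤ = decide (g * y <? s * (t + 0)) (g * y′ <? s * (t + (y′ + 0)))
    where
    y′ = (y + z) + x
    Exceeds : Set
    Exceeds = ∃ λ k → g * α k x y z < s * (t + τ k x y z)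
    decide : Dec (g * y < s * (t + 0)) → Dec (g * y′ < s * (t + (y′ + 0))) → Exceeds
    decide (yes exceeds₀) _ = 0 , exceeds₀
    decide (no _) (yes exceeds₁) = 1 , exceeds₁
    decide (no ¬exceeds₀) (no ¬exceeds₁) =
      let k , exceeds = exceeds-from j ((x + y) + (y + z)) y′ (x + y) (t + y′) (≤-trans x≥1 (≤-trans (m≤m+n x y) (m≤m+n _ _)))
            (descend x y z t j x≥1 (subst (λ w → s * w ≤ g * y) (+-identityʳ t) (≮⇒≥ ¬exceeds₀))
              (subst (λ w → s * (t + w) ≤ g * y′) (+-identityʳ y′) (≮⇒≥ ¬exceeds₁)) EV≤)
      in suc k , subst (λ w → g * α (suc k) x y z < s * w) (+-assoc t y′ _) exceeds

  exceeds : ∀ x y z → 1 ≤ x → ∃ λ k → g * α k x y z < s * τ k x y z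
  exceeds x y z x≥1 =
    -- One decoding is made first to have `t ≥ 1`; then `E` itself can serve as the counter.
    let k , exceeds = exceeds-from E ((x + y) + (y + z)) t (x + y) t (≤-trans x≥1 (≤-trans (m≤m+n x y) (m≤m+n _ _)))
          (m≤m*n E t {{>-nonZero (≤-trans x≥1 (m≤n+m x _))}})
    in suc k , exceeds
    where
    t = (y + z) + x
    E = m * g * V ((x + y) + (y + z)) t (x + y)

-- The repetitions forced by decoding

open Coding 𝟎 φ

-- flip (lt k) is the last letter of 𝔸 k, and lt k is a letter preceding 𝔸 k ++ 𝕋 k; as neither is 2,
-- the images of both end in 21, which prolongs the repetition to the left
flip : Letter → Letter
flip 𝟎 = 𝟏
flip _ = 𝟎

before : Letter → FinWord
before 𝟎 = 𝟎 ∷ []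
before _ = []

lt : ℕ → Letter
lt zero = 𝟎
lt (suc k) = flip (lt k)

-- Everything in `𝔸 k` but its last letter, which is split off because its image supplies the 21
-- that moves from the end to the front.
stem : ℕ → FinWord
stem zero = []
stem (suc k) = 𝟐 ∷ 𝟏 ∷ image (stem k) ++ before (flip (lt k))

-- The image of `𝔸 k`, conjugated by 21, is `𝔸 (suc k)`. The image of `𝕋 k` gains 21 on the left
-- and, since every return starts with `𝟎`, a 0 on the right. From the single letter 1 the first
-- decoding gives the square of 210.
𝔸 𝕋 : ℕ → FinWord
𝔸 k = stem k ∷ʳ flip (lt k)
𝕋 zero = []
𝕋 (suc k) = 𝟐 ∷ 𝟏 ∷ image (𝕋 k) ∷ʳ 𝟎

-- The equation fails for `𝟐`, but a value of `flip` is never `𝟐`.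
image-flip : ∀ k → image (lt k ∷ []) ≡ before (lt k) ++ flip (lt k) ∷ 𝟐 ∷ 𝟏 ∷ []
image-flip zero = refl
image-flip (suc zero) = refl
image-flip (suc (suc k)) with lt k
... | 𝟎 = refl
... | 𝟏 = refl
... | 𝟐 = refl

image-A : ∀ k → 𝟐 ∷ 𝟏 ∷ image (𝔸 k) ≡ 𝔸 (suc k) ++ 𝟐 ∷ 𝟏 ∷ []
image-A k = cong (λ w → 𝟐 ∷ 𝟏 ∷ w) (begin
  image (stem k ∷ʳ flip (lt k))                                               ≡⟨ image-++ (stem k) _ ⟩
  image (stem k) ++ image (flip (lt k) ∷ [])                                  ≡⟨ cong (image (stem k) ++_) (image-flip (suc k)) ⟩
  image (stem k) ++ before (flip (lt k)) ++ flip (flip (lt k)) ∷ 𝟐 ∷ 𝟏 ∷ []   ≡⟨ ++-assoc (image (stem k)) _ _ ⟨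
  (image (stem k) ++ before (flip (lt k))) ++ flip (flip (lt k)) ∷ 𝟐 ∷ 𝟏 ∷ [] ≡⟨ ++-assoc (image (stem k) ++ before (flip (lt k))) (flip (flip (lt k)) ∷ []) _ ⟨
  ((image (stem k) ++ before (flip (lt k))) ∷ʳ flip (flip (lt k))) ++ 𝟐 ∷ 𝟏 ∷ [] ∎)
  where open ≡-Reasoning

cb-enc-AT : ∀ k u → 𝟐 ∷ 𝟏 ∷ enc (𝔸 k ++ u) ≡ 𝔸 (suc k) ++ 𝟐 ∷ 𝟏 ∷ enc u
cb-enc-AT k u = begin
  𝟐 ∷ 𝟏 ∷ enc (𝔸 k ++ u)              ≡⟨ cong (λ w → 𝟐 ∷ 𝟏 ∷ w) (enc-++ (𝔸 k) u) ⟩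
  (𝟐 ∷ 𝟏 ∷ image (𝔸 k)) ++ enc u      ≡⟨ cong (_++ enc u) (image-A k) ⟩
  (𝔸 (suc k) ++ 𝟐 ∷ 𝟏 ∷ []) ++ enc u  ≡⟨ ++-assoc (𝔸 (suc k)) _ _ ⟩
  𝔸 (suc k) ++ 𝟐 ∷ 𝟏 ∷ enc u          ∎
  where open ≡-Reasoning

A-period : ∀ k → ∃ λ Z → 𝔸 k ++ 𝕋 k ≡ 𝕋 k ++ Z
A-period zero = 𝟏 ∷ [] , refl
A-period (suc k) with A-period k
... | Z , AT≡TZ with enc-head Z
... | Z′ , enc-Z = Z′ , (begin
  𝔸 (suc k) ++ 𝟐 ∷ 𝟏 ∷ enc (𝕋 k)         ≡⟨ cb-enc-AT k (𝕋 k) ⟨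
  𝟐 ∷ 𝟏 ∷ enc (𝔸 k ++ 𝕋 k)               ≡⟨ cong (λ w → 𝟐 ∷ 𝟏 ∷ enc w) AT≡TZ ⟩
  𝟐 ∷ 𝟏 ∷ enc (𝕋 k ++ Z)                 ≡⟨ cong (λ w → 𝟐 ∷ 𝟏 ∷ w) (enc-++ (𝕋 k) Z) ⟩
  𝟐 ∷ 𝟏 ∷ image (𝕋 k) ++ enc Z           ≡⟨ cong (λ w → 𝟐 ∷ 𝟏 ∷ image (𝕋 k) ++ w) enc-Z ⟩
  𝟐 ∷ 𝟏 ∷ image (𝕋 k) ++ 𝟎 ∷ Z′          ≡⟨ cong (λ w → 𝟐 ∷ 𝟏 ∷ w) (++-assoc (image (𝕋 k)) (𝟎 ∷ []) Z′) ⟨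
  𝕋 (suc k) ++ Z′                        ∎)
  where open ≡-Reasoning

wt-enc : ∀ ω u → wt ω (enc u) ≡ wt (weight ω) u + ω 𝟎
wt-enc ω u = trans (wt-++ ω (image u) (𝟎 ∷ [])) (cong₂ _+_ (wt-image ω u) (+-identityʳ (ω 𝟎)))

weight-a : ∀ ω → weight ω 𝟎 ≡ (ω 𝟎 + ω 𝟏) + (ω 𝟏 + ω 𝟐)
weight-a ω = eq (ω 𝟎) (ω 𝟏) (ω 𝟐)
  where
  eq : ∀ x y z → x + (y + (z + (y + 0))) ≡ (x + y) + (y + z)
  eq = solve-∀

weight-b : ∀ ω → weight ω 𝟏 ≡ (ω 𝟏 + ω 𝟐) + ω 𝟎
weight-b ω = eq (ω 𝟎) (ω 𝟏) (ω 𝟐)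
  where
  eq : ∀ x y z → x + (z + (y + 0)) ≡ (y + z) + x
  eq = solve-∀

weight-c : ∀ ω → weight ω 𝟐 ≡ ω 𝟎 + ω 𝟏
weight-c ω = cong (ω 𝟎 +_) (+-identityʳ (ω 𝟏))

cong₃ : ∀ (h : ℕ → ℕ → ℕ → ℕ) {x x′ y y′ z z′} → x ≡ x′ → y ≡ y′ → z ≡ z′ → h x y z ≡ h x′ y′ z′
cong₃ h refl refl refl = refl

wt-A : ∀ k ω → wt ω (𝔸 k) ≡ α k (ω 𝟎) (ω 𝟏) (ω 𝟐)
wt-A zero ω = +-identityʳ (ω 𝟏)
wt-A (suc k) ω = begin
  wt ω (𝔸 (suc k))                                ≡⟨ +-cancelʳ-≡ (wt ω (𝟐 ∷ 𝟏 ∷ [])) _ _ rotate ⟩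
  wt ω (image (𝔸 k))                              ≡⟨ wt-image ω (𝔸 k) ⟩
  wt (weight ω) (𝔸 k)                             ≡⟨ wt-A k (weight ω) ⟩
  α k (weight ω 𝟎) (weight ω 𝟏) (weight ω 𝟐)      ≡⟨ cong₃ (α k) (weight-a ω) (weight-b ω) (weight-c ω) ⟩
  α (suc k) (ω 𝟎) (ω 𝟏) (ω 𝟐)                     ∎
  where
  open ≡-Reasoning
  rotate : wt ω (𝔸 (suc k)) + wt ω (𝟐 ∷ 𝟏 ∷ []) ≡ wt ω (image (𝔸 k)) + wt ω (𝟐 ∷ 𝟏 ∷ [])
  rotate = begin
    wt ω (𝔸 (suc k)) + wt ω (𝟐 ∷ 𝟏 ∷ [])   ≡⟨ wt-++ ω (𝔸 (suc k)) _ ⟨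
    wt ω (𝔸 (suc k) ++ 𝟐 ∷ 𝟏 ∷ [])         ≡⟨ cong (wt ω) (image-A k) ⟨
    wt ω (𝟐 ∷ 𝟏 ∷ image (𝔸 k))             ≡⟨ wt-++ ω (𝟐 ∷ 𝟏 ∷ []) (image (𝔸 k)) ⟩
    wt ω (𝟐 ∷ 𝟏 ∷ []) + wt ω (image (𝔸 k)) ≡⟨ +-comm (wt ω (𝟐 ∷ 𝟏 ∷ [])) _ ⟩
    wt ω (image (𝔸 k)) + wt ω (𝟐 ∷ 𝟏 ∷ []) ∎

-- The letters 2, 1, 0 gained in a decoding weigh as much as `𝔸 1`, whence the summand `α 1`.
wt-T : ∀ k ω → wt ω (𝕋 k) ≡ τ k (ω 𝟎) (ω 𝟏) (ω 𝟐)
wt-T zero ω = refl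
wt-T (suc k) ω = begin
  ω 𝟐 + (ω 𝟏 + wt ω (enc (𝕋 k)))                              ≡⟨ cong (λ n → ω 𝟐 + (ω 𝟏 + n)) (wt-enc ω (𝕋 k)) ⟩
  ω 𝟐 + (ω 𝟏 + (wt (weight ω) (𝕋 k) + ω 𝟎))                   ≡⟨ eq (ω 𝟎) (ω 𝟏) (ω 𝟐) _ ⟩
  (ω 𝟏 + ω 𝟐) + ω 𝟎 + wt (weight ω) (𝕋 k)                     ≡⟨ cong ((ω 𝟏 + ω 𝟐) + ω 𝟎 +_) (wt-T k (weight ω)) ⟩
  (ω 𝟏 + ω 𝟐) + ω 𝟎 + τ k (weight ω 𝟎) (weight ω 𝟏) (weight ω 𝟐) ≡⟨ cong ((ω 𝟏 + ω 𝟐) + ω 𝟎 +_) (cong₃ (τ k) (weight-a ω) (weight-b ω) (weight-c ω)) ⟩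
  τ (suc k) (ω 𝟎) (ω 𝟏) (ω 𝟐)                                  ∎
  where
  open ≡-Reasoning
  eq : ∀ x y z t → z + (y + (t + x)) ≡ (y + z) + x + t
  eq = solve-∀

occ-sum : ∀ ω u → wt ω u ≡ ω 𝟎 * occ 𝟎 u + ω 𝟏 * occ 𝟏 u + ω 𝟐 * occ 𝟐 u
occ-sum ω [] = sym (cong₂ _+_ (cong₂ _+_ (*-zeroʳ (ω 𝟎)) (*-zeroʳ (ω 𝟏))) (*-zeroʳ (ω 𝟐)))
occ-sum ω (𝟎 ∷ u) = trans (cong (ω 𝟎 +_) (occ-sum ω u)) (eq (ω 𝟎) (ω 𝟏) (ω 𝟐) (occ 𝟎 u) (occ 𝟏 u) (occ 𝟐 u))
  where
  eq : ∀ x y z i j k → x + (x * i + y * j + z * k) ≡ x * suc i + y * j + z * k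
  eq = solve-∀
occ-sum ω (𝟏 ∷ u) = trans (cong (ω 𝟏 +_) (occ-sum ω u)) (eq (ω 𝟎) (ω 𝟏) (ω 𝟐) (occ 𝟎 u) (occ 𝟏 u) (occ 𝟐 u))
  where
  eq : ∀ x y z i j k → y + (x * i + y * j + z * k) ≡ x * i + y * suc j + z * k
  eq = solve-∀
occ-sum ω (𝟐 ∷ u) = trans (cong (ω 𝟐 +_) (occ-sum ω u)) (eq (ω 𝟎) (ω 𝟏) (ω 𝟐) (occ 𝟎 u) (occ 𝟏 u) (occ 𝟐 u))
  where
  eq : ∀ x y z i j k → z + (x * i + y * j + z * k) ≡ x * i + y * j + z * suc k
  eq = solve-∀

heavy-wt : ∀ ω A T → heavy A T ≡ true → 3 * wt ω A ≤ 2 * wt ω T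
heavy-wt ω A T@(_ ∷ _) eq with all-true (λ x → (3 * occ x A) ≤ᵇ (2 * occ x T)) letters eq
... | ha ∷ hb ∷ hc ∷ [] = begin
  3 * wt ω A                                                  ≡⟨ cong (3 *_) (occ-sum ω A) ⟩
  3 * (ω 𝟎 * occ 𝟎 A + ω 𝟏 * occ 𝟏 A + ω 𝟐 * occ 𝟐 A)         ≡⟨ eq₃ (ω 𝟎) (ω 𝟏) (ω 𝟐) (occ 𝟎 A) (occ 𝟏 A) (occ 𝟐 A) ⟩
  ω 𝟎 * (3 * occ 𝟎 A) + ω 𝟏 * (3 * occ 𝟏 A) + ω 𝟐 * (3 * occ 𝟐 A)
    ≤⟨ +-mono-≤ (+-mono-≤ (*-monoʳ-≤ (ω 𝟎) (le ha)) (*-monoʳ-≤ (ω 𝟏) (le hb))) (*-monoʳ-≤ (ω 𝟐) (le hc)) ⟩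
  ω 𝟎 * (2 * occ 𝟎 T) + ω 𝟏 * (2 * occ 𝟏 T) + ω 𝟐 * (2 * occ 𝟐 T) ≡⟨ eq₂ (ω 𝟎) (ω 𝟏) (ω 𝟐) (occ 𝟎 T) (occ 𝟏 T) (occ 𝟐 T) ⟨
  2 * (ω 𝟎 * occ 𝟎 T + ω 𝟏 * occ 𝟏 T + ω 𝟐 * occ 𝟐 T)         ≡⟨ cong (2 *_) (occ-sum ω T) ⟨
  2 * wt ω T                                                  ∎
  where
  open ≤-Reasoning
  le : ∀ {i j} → (i ≤ᵇ j) ≡ true → i ≤ j
  le {i} h = ≤ᵇ⇒≤ i _ (subst Data.Bool.T (sym h) _)
  eq₃ : ∀ x y z i j k → 3 * (x * i + y * j + z * k) ≡ x * (3 * i) + y * (3 * j) + z * (3 * k)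
  eq₃ = solve-∀
  eq₂ : ∀ x y z i j k → 2 * (x * i + y * j + z * k) ≡ x * (2 * i) + y * (2 * j) + z * (2 * k)
  eq₂ = solve-∀

wt-bounds : ∀ ω B u → (∀ x → 1 ≤ ω x × ω x ≤ B) → length u ≤ wt ω u × wt ω u ≤ B * length u
wt-bounds ω B [] _ = z≤n , z≤n
wt-bounds ω B (x ∷ u) bounds with wt-bounds ω B u bounds
... | lower , upper = +-mono-≤ (proj₁ (bounds x)) lower
                    , ≤-trans (+-mono-≤ (proj₂ (bounds x)) upper) (≤-reflexive (sym (*-suc B (length u))))

-- Refutation of all languages

-- the last condition says that the exponent 1 + t / p is above 1 + g / s
Rep : ℕ → ℕ → ℕ → ℕ → ℕ → Set
Rep g s N p t = 1 ≤ p × p + t ≤ N × g * p < s * t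

-- The hypothesis puts the threshold `1 + g / s` below 5/2, so whatever `long` or `heavy` detects is
-- above it.
module Derived (g s N : ℕ) (2g<3s : 2 * g < 3 * s) where
  open Avoiding (Rep g s N)
  open Language

  rep-from : ∀ {p t} → 1 ≤ p → p + t ≤ N → 3 * p ≤ 2 * t → Rep g s N p t
  rep-from {p} {t} p≥1 p+t≤N 3p≤2t = p≥1 , p+t≤N , *-cancelˡ-< 2 _ _ (begin-strict
    2 * (g * p)  ≡⟨ *-assoc 2 g p ⟨
    2 * g * p    <⟨ *-monoˡ-< p {{>-nonZero p≥1}} 2g<3s ⟩
    3 * s * p    ≡⟨ e₁ s p ⟩
    s * (3 * p)  ≤⟨ *-monoʳ-≤ s 3p≤2t ⟩
    s * (2 * t)  ≡⟨ e₂ s t ⟩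
    2 * (s * t)  ∎)
    where
    open ≤-Reasoning
    e₁ : ∀ s p → 3 * s * p ≡ s * (3 * p)
    e₁ = solve-∀
    e₂ : ∀ s t → s * (2 * t) ≡ 2 * (s * t)
    e₂ = solve-∀

  -- The cut-offs 40 and 60 of the search leave at most 100 letters, of weight at most `B` each.
  rep-from-weights : ∀ ω B → (∀ x → 1 ≤ ω x × ω x ≤ B) → B * 100 ≤ N → ∀ A T → 1 ≤ length A → length A ≤ 40 → length T ≤ 60 →
    3 * wt ω A ≤ 2 * wt ω T → Rep g s N (wt ω A) (wt ω T)
  rep-from-weights ω B bounds BN A T A≥1 A≤40 T≤60 3A≤2T with wt-bounds ω B A bounds | wt-bounds ω B T bounds
  ... | lowA , upA | lowT , upT = rep-from (≤-trans A≥1 lowA) (begin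
    wt ω A + wt ω T               ≤⟨ +-mono-≤ upA upT ⟩
    B * length A + B * length T   ≡⟨ *-distribˡ-+ B (length A) (length T) ⟨
    B * (length A + length T)     ≤⟨ *-monoʳ-≤ B (+-mono-≤ A≤40 T≤60) ⟩
    B * 100                       ≤⟨ BN ⟩
    N                             ∎) 3A≤2T
    where open ≤-Reasoning

  heavy⇒Rep : ∀ ω B → (∀ x → 1 ≤ ω x × ω x ≤ B) → B * 100 ≤ N → ∀ A T → 1 ≤ length A → length A ≤ 40 → length T ≤ 60 →
    heavy A T ≡ true → Rep g s N (wt ω A) (wt ω T)
  heavy⇒Rep ω B bounds BN A T A≥1 A≤40 T≤60 h = rep-from-weights ω B bounds BN A T A≥1 A≤40 T≤60 (heavy-wt ω A T h)

  long⇒Rep : 100 ≤ N → ∀ A T → 1 ≤ length A → length A ≤ 40 → length T ≤ 60 →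
    long A T ≡ true → Rep g s N (wt unit A) (wt unit T)
  long⇒Rep 100≤N A T@(_ ∷ _) A≥1 A≤40 T≤60 h = rep-from-weights unit 1 (λ _ → ≤-refl , ≤-refl) 100≤N A T A≥1 A≤40 T≤60
    (subst (λ n → 3 * n ≤ 2 * wt unit T) (sym (wt-unit A))
      (subst (λ n → 3 * length A ≤ 2 * n) (sym (wt-unit T)) (≤ᵇ⇒≤ (3 * length A) _ (subst Data.Bool.T (sym h) _))))

  weight-bounds : ∀ {ω B} → (∀ x → 1 ≤ ω x × ω x ≤ B) → ∀ x → 1 ≤ weight ω x × weight ω x ≤ B * 4
  weight-bounds {ω} {B} bounds x = ≤-trans (proj₁ (bounds 𝟎)) (m≤m+n _ _) , (begin
    wt ω (𝟎 ∷ φ x)         ≤⟨ proj₂ (wt-bounds ω B (𝟎 ∷ φ x) bounds) ⟩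
    B * length (𝟎 ∷ φ x)   ≤⟨ *-monoʳ-≤ B (short x) ⟩
    B * 4                  ∎)
    where
    open ≤-Reasoning
    short : ∀ x → length (𝟎 ∷ φ x) ≤ 4
    short 𝟎 = ≤-refl
    short 𝟏 = m≤n+m 3 1
    short 𝟐 = m≤n+m 2 2

  -- Induction over all languages and weights at once. A return has at most four letters, so `B`
  -- becomes `B * 4` while `k` drops by one, and the bound by `N` is the same along the whole chain
  -- of decodings.
  repetition-occurs : ∀ k ω B R → (∀ x → 1 ≤ ω x × ω x ≤ B) → B * 4 ^ k * 100 ≤ N → Language ω R → All (¬_ ∘ R) forbidden →
    ¬ ¬ R (lt k ∷ 𝔸 k ++ 𝕋 k)
  repetition-occurs zero ω B R bounds BN L ¬F ¬ab =
    nonempty L (dead-sound L (¬ab ∷ ¬F) [] ab-occurs)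
    where
    open Search 60 heavy
    open Soundness (Rep g s N) ω (heavy⇒Rep ω B bounds (subst (λ n → n * 100 ≤ N) (*-identityʳ B) BN))
  repetition-occurs (suc k) ω B R bounds BN L ¬F ¬r = repetition-occurs k (weight ω) (B * 4) (R ∘ enc) (weight-bounds bounds)
    (subst (λ n → n * 100 ≤ N) (sym (*-assoc B 4 (4 ^ k))) BN) (proj₁ derived) (proj₂ derived)
    (λ r → ¬r (suffix L (before (lt k)) (subst R (trans (enc-++ (lt k ∷ []) (𝔸 k ++ 𝕋 k)) eq) r)))
    where
    B≤ : B * 100 ≤ N
    B≤ = ≤-trans (*-monoˡ-≤ 100 (m≤m*n B (4 ^ suc k) {{>-nonZero (m^n>0 4 (suc k))}})) BN
    open Derivation 60 8 heavy
    open DerivationSoundness (Rep g s N) ω (heavy⇒Rep ω B bounds B≤)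
    derived = derive L ¬F 𝟎 φ φ-derivable
    open ≡-Reasoning
    eq : image (lt k ∷ []) ++ enc (𝔸 k ++ 𝕋 k) ≡ before (lt k) ++ flip (lt k) ∷ 𝔸 (suc k) ++ 𝕋 (suc k)
    eq = begin
      image (lt k ∷ []) ++ enc (𝔸 k ++ 𝕋 k)                          ≡⟨ cong (_++ enc (𝔸 k ++ 𝕋 k)) (image-flip k) ⟩
      (before (lt k) ++ flip (lt k) ∷ 𝟐 ∷ 𝟏 ∷ []) ++ enc (𝔸 k ++ 𝕋 k) ≡⟨ ++-assoc (before (lt k)) _ _ ⟩
      before (lt k) ++ flip (lt k) ∷ 𝟐 ∷ 𝟏 ∷ enc (𝔸 k ++ 𝕋 k)        ≡⟨ cong (λ w → before (lt k) ++ flip (lt k) ∷ w) (cb-enc-AT k (𝕋 k)) ⟩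
      before (lt k) ++ flip (lt k) ∷ 𝔸 (suc k) ++ 𝕋 (suc k)          ∎

  A≥1 : ∀ k → 1 ≤ length (𝔸 k)
  A≥1 k = ≤-trans (m≤n+m 1 (length (stem k))) (≤-reflexive (sym (length-++ (stem k))))

  no-derived-language : ∀ k ω B R → (∀ x → 1 ≤ ω x × ω x ≤ B) → B * 4 ^ k * 100 ≤ N →
    α k (ω 𝟎) (ω 𝟏) (ω 𝟐) + τ k (ω 𝟎) (ω 𝟏) (ω 𝟐) ≤ N →
    g * α k (ω 𝟎) (ω 𝟏) (ω 𝟐) < s * τ k (ω 𝟎) (ω 𝟏) (ω 𝟐) →
    Language ω R → All (¬_ ∘ R) forbidden → ⊥
  no-derived-language k ω B R bounds BN len long L ¬F with A-period k
  ... | Z , AT≡TZ = repetition-occurs k ω B R bounds BN L ¬F λ r →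
    light L (𝔸 k) (𝕋 k) Z AT≡TZ
      ( ≤-trans (A≥1 k) (proj₁ (wt-bounds ω B (𝔸 k) bounds))
      , subst (_≤ N) (sym (cong₂ _+_ (wt-A k ω) (wt-T k ω))) len
      , subst (λ n → g * n < s * wt ω (𝕋 k)) (sym (wt-A k ω)) (subst (λ n → g * α k (ω 𝟎) (ω 𝟏) (ω 𝟐) < s * n) (sym (wt-T k ω)) long))
      (suffix L (lt k ∷ []) r)

  -- A letter at a leaf weighs one more than its block of at most eight letters; `beaten` ranges
  -- over the resulting 729 triples of weights.
  module _ (100≤N : 100 ≤ N)
    (beaten : ∀ x y z → x ≤ 8 → y ≤ 8 → z ≤ 8 → ∃ λ k → 9 * 4 ^ k * 100 ≤ N
      × α k (suc x) (suc y) (suc z) + τ k (suc x) (suc y) (suc z) ≤ N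
      × g * α k (suc x) (suc y) (suc z) < s * τ k (suc x) (suc y) (suc z)) where

    no-language : ∀ R → Language unit R → Counted R → R [] → ⊥
    no-language R L cnt r = checkAll-sound [] [] cases root cases-valid L cnt [] (r ∷ [])
      where
      refute : ∀ ω R → (∀ x → 1 ≤ ω x × ω x ≤ 9) → Language ω R → All (¬_ ∘ R) forbidden → ⊥
      refute ω R bounds L ¬F with ω 𝟎 in eqa | ω 𝟏 in eqb | ω 𝟐 in eqc | bounds 𝟎 | bounds 𝟏 | bounds 𝟐
      ... | suc x | suc y | suc z | _ , s≤s x≤8 | _ , s≤s y≤8 | _ , s≤s z≤8 with beaten x y z x≤8 y≤8 z≤8
      ... | k , BN , len , long = no-derived-language k ω 9 R bounds BN
        (subst (_≤ N) (cong₂ _+_ (eqs (α k)) (eqs (τ k))) len)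
        (subst (λ n → g * n < s * τ k (ω 𝟎) (ω 𝟏) (ω 𝟐)) (eqs (α k))
          (subst (λ n → g * α k (suc x) (suc y) (suc z) < s * n) (eqs (τ k)) long))
        L ¬F
        where
        eqs : ∀ h → h (suc x) (suc y) (suc z) ≡ h (ω 𝟎) (ω 𝟏) (ω 𝟐)
        eqs h = sym (cong₃ h eqa eqb eqc)
      open CheckerSoundness 60 8 long (Rep g s N) (long⇒Rep 100≤N) refute

-- Recurrent words of an infinite word

letter : Fin 3 → Letter
letter Fin.zero = 𝟎
letter (Fin.suc Fin.zero) = 𝟏
letter (Fin.suc (Fin.suc Fin.zero)) = 𝟐

letter-injective : ∀ {x y} → letter x ≡ letter y → x ≡ y
letter-injective {Fin.zero} {Fin.zero} _ = refl
letter-injective {Fin.suc Fin.zero} {Fin.suc Fin.zero} _ = refl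
letter-injective {Fin.suc (Fin.suc Fin.zero)} {Fin.suc (Fin.suc Fin.zero)} _ = refl
letter-injective {Fin.zero} {Fin.suc Fin.zero} ()
letter-injective {Fin.zero} {Fin.suc (Fin.suc Fin.zero)} ()
letter-injective {Fin.suc Fin.zero} {Fin.zero} ()
letter-injective {Fin.suc Fin.zero} {Fin.suc (Fin.suc Fin.zero)} ()
letter-injective {Fin.suc (Fin.suc Fin.zero)} {Fin.zero} ()
letter-injective {Fin.suc (Fin.suc Fin.zero)} {Fin.suc Fin.zero} ()

unique-⊆-length : ∀ {X : Set} (L M : List X) → Unique L → All (_∈ M) L → length L ≤ length M
unique-⊆-length [] M _ _ = z≤n
unique-⊆-length (x ∷ L) M (x∉L ∷ L!) (x∈M ∷ L⊆M) with ∈-∃++ x∈M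
... | M₁ , M₂ , refl = begin
  suc (length L)                  ≤⟨ s≤s (unique-⊆-length L (M₁ ++ M₂) L! (All.zipWith remove (x∉L , L⊆M))) ⟩
  suc (length (M₁ ++ M₂))         ≡⟨ cong suc (length-++ M₁) ⟩
  suc (length M₁ + length M₂)     ≡⟨ +-suc (length M₁) (length M₂) ⟨
  length M₁ + suc (length M₂)     ≡⟨ length-++ M₁ ⟨
  length (M₁ ++ x ∷ M₂)           ∎
  where
  open ≤-Reasoning
  remove : ∀ {y} → (¬ x ≡ y) × y ∈ M₁ ++ x ∷ M₂ → y ∈ M₁ ++ M₂
  remove (x≢y , y∈) with ∈-++⁻ M₁ y∈
  ... | inj₁ y∈M₁ = ∈-++⁺ˡ y∈M₁
  ... | inj₂ (here y≡x) = ⊥-elim (x≢y (sym y≡x))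
  ... | inj₂ (there y∈M₂) = ∈-++⁺ʳ M₁ y∈M₂

-- The double negation shift is available for finite lists.
¬¬-All : ∀ {X : Set} {P : X → Set} (L : List X) → All (λ x → ¬ ¬ P x) L → ¬ ¬ All P L
¬¬-All [] _ k = k []
¬¬-All (x ∷ L) (px ∷ pL) k = px λ p → ¬¬-All L pL λ ps → k (p ∷ ps)

least : ∀ {P : ℕ → Set} → Decidable P → ∀ bound n → n ≤ bound → P n → ∃ λ k → k ≤ n × P k × (∀ k′ → P k′ → k ≤ k′)
least P? zero zero _ p = 0 , z≤n , p , λ _ _ → z≤n
least P? (suc bound) n n≤ p with anyUpTo? P? n
... | no none = n , ≤-refl , p , λ k′ p′ → ≮⇒≥ (λ k′<n → none (k′ , k′<n , p′))
... | yes (k , k<n , pk) with least P? bound k (≤-pred (≤-trans k<n n≤)) pk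
... | k₀ , k₀≤k , p₀ , min = k₀ , ≤-trans k₀≤k (<⇒≤ k<n) , p₀ , min
least P? zero (suc n) () _

module Recurrence (w : Word) where

  Occ : FinWord → ℕ → Set
  Occ [] j = ⊤
  Occ (x ∷ u) j = letter (w j) ≡ x × Occ u (suc j)

  Recurrent : FinWord → Set
  Recurrent u = ∀ i → ¬ ¬ ∃ λ j → i ≤ j × Occ u j

  Occ-++⁻ : ∀ u {v} j → Occ (u ++ v) j → Occ u j × Occ v (j + length u)
  Occ-++⁻ [] {v} j occ = tt , subst (Occ v) (sym (+-identityʳ j)) occ
  Occ-++⁻ (x ∷ u) {v} j (eq , occ) with Occ-++⁻ u (suc j) occ
  ... | occ-u , occ-v = (eq , occ-u) , subst (Occ v) (sym (+-suc j (length u))) occ-v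

  Occ-++⁺ : ∀ u {v} j → Occ u j → Occ v (j + length u) → Occ (u ++ v) j
  Occ-++⁺ [] {v} j _ occ = subst (Occ v) (+-identityʳ j) occ
  Occ-++⁺ (x ∷ u) {v} j (eq , occ-u) occ-v = eq , Occ-++⁺ u (suc j) occ-u (subst (Occ v) (+-suc j (length u)) occ-v)

  Occ-agree : ∀ u i j → Occ u i → Occ u j → ∀ n → n < length u → w (i + n) ≡ w (j + n)
  Occ-agree (x ∷ u) i j (eqi , _) (eqj , _) zero _ =
    letter-injective (subst₂ (λ k l → letter (w k) ≡ letter (w l)) (sym (+-identityʳ i)) (sym (+-identityʳ j)) (trans eqi (sym eqj)))
  Occ-agree (x ∷ u) i j (_ , occi) (_ , occj) (suc n) (s≤s n<) =
    subst₂ (λ k l → w k ≡ w l) (sym (+-suc i n)) (sym (+-suc j n)) (Occ-agree u (suc i) (suc j) occi occj n n<)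

  toWord : ∀ {n} → Vec (Fin 3) n → FinWord
  toWord v = map letter (toList v)

  Occ⇒factorAt : ∀ u j → Occ u j → u ≡ toWord (factorAt w j (length u))
  Occ⇒factorAt [] j _ = refl
  Occ⇒factorAt (x ∷ u) j (eq , occ) = cong₂ _∷_
    (trans (sym eq) (cong (letter ∘ w) (sym (+-identityʳ j))))
    (trans (Occ⇒factorAt u (suc j) occ) (cong toWord (tabulate-cong (λ k → cong w (sym (+-suc j (toℕ k)))))))

  eventually-absent : ∀ {u} → ¬ Recurrent u → ¬ ¬ ∃ λ i → ∀ j → i ≤ j → ¬ Occ u j
  eventually-absent ¬rec k = ¬rec λ i none → k (i , λ j i≤j occ → none (j , i≤j , occ))

  -- If no extension recurred, all three would be absent beyond the largest of three positions, yet
  -- one of them occurs there.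
  recurrent-one-of : ∀ (ext : Letter → FinWord) → (∀ i → ¬ ¬ ∃ λ j → i ≤ j × ∃ λ x → Occ (ext x) j) →
                     ¬ ¬ ∃ λ x → Recurrent (ext x)
  recurrent-one-of ext often none =
    eventually-absent (λ r → none (𝟎 , r)) λ { (i , absent-a) →
    eventually-absent (λ r → none (𝟏 , r)) λ { (j , absent-b) →
    eventually-absent (λ r → none (𝟐 , r)) λ { (k , absent-c) →
    often (i ⊔ (j ⊔ k)) λ
      { (n , le , 𝟎 , occ) → absent-a n (≤-trans (m≤m⊔n i _) le) occ
      ; (n , le , 𝟏 , occ) → absent-b n (≤-trans (≤-trans (m≤m⊔n j k) (m≤n⊔m i _)) le) occ
      ; (n , le , 𝟐 , occ) → absent-c n (≤-trans (≤-trans (m≤n⊔m j k) (m≤n⊔m i _)) le) occ } } } }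

  -- An inequality of numbers is decidable, hence stable, which removes the double negations that
  -- come with recurrence.
  recurrent-counted : ComplexityTwoNPlusOne w → Counted Recurrent
  recurrent-counted cplx n L L! rL len with cplx n
  ... | M , _ , length-M , iff = decidable-stable (length L ≤? suc (2 * n)) λ ¬le →
    ¬¬-All L (All.zipWith (λ {u} → member {u}) (rL , len)) λ L⊆M → ¬le (begin
      length L                   ≤⟨ unique-⊆-length L (map toWord M) L! L⊆M ⟩
      length (map toWord M)      ≡⟨ length-map toWord M ⟩
      length M                   ≡⟨ length-M ⟩
      suc (2 * n)                ∎)
    where
    open ≤-Reasoning
    member : ∀ {u} → Recurrent u × length u ≡ n → ¬ ¬ (u ∈ map toWord M)
    member {u} (r , refl) k = r 0 λ { (j , _ , occ) → k (subst (_∈ map toWord M) (sym (Occ⇒factorAt u j occ))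
      (∈-map⁺ toWord (Equivalence.from (iff (factorAt w j n)) (j , refl)))) }

  module _ (Bad : ℕ → ℕ → Set) (none : ∀ i p t → Bad p t → ¬ (∀ n → n < t → w (i + n) ≡ w (i + p + n))) where
    open Avoiding Bad

    recurrent-language : Language unit Recurrent
    recurrent-language = record
      { nonempty = λ k → k λ i k → k (i , ≤-refl , tt)
      ; factor = λ u {v} z r i k → r i λ { (j , i≤j , occ) →
          k (j + length u , ≤-trans i≤j (m≤m+n j _) , proj₁ (Occ-++⁻ v _ (proj₂ (Occ-++⁻ u j occ)))) }
      -- An occurrence at `suc i` or later leaves room for a letter before it.
      ; left = λ u r → recurrent-one-of (_∷ u) λ i k → r (suc i) λ
          { (suc j , s≤s i≤j , occ) → k (j , i≤j , letter (w j) , refl , occ) }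
      ; right = λ u r → recurrent-one-of (u ∷ʳ_) λ i k → r i λ
          { (j , i≤j , occ) → k (j , i≤j , letter (w (j + length u)) , Occ-++⁺ u j occ (refl , tt)) }
      ; light = λ A T Z eq bad r → r 0 λ { (j , _ , occ) →
          none j (wt unit A) (wt unit T) bad λ n n< → Occ-agree T j _ (proj₁ (Occ-++⁻ T j (subst (λ u → Occ u j) eq occ)))
            (subst (λ p → Occ T (j + p)) (sym (wt-unit A)) (proj₂ (Occ-++⁻ A j occ))) n (subst (n <_) (wt-unit T) n<) }
      }

-- Deciding the existence of bounded repetitions

factorAt-agree : ∀ (w : Word) i i′ m → factorAt w i m ≡ factorAt w i′ m → ∀ j → j < m → w (i + j) ≡ w (i′ + j)
factorAt-agree w i i′ m eq j j<m = trans (sym (at i)) (trans (cong (λ v → lookup v (fromℕ< j<m)) eq) (at i′))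
  where
  at : ∀ i → lookup (factorAt w i m) (fromℕ< j<m) ≡ w (i + j)
  at i = trans (lookup∘tabulate _ (fromℕ< j<m)) (cong (λ k → w (i + k)) (toℕ-fromℕ< j<m))

isPeriod? : ∀ w i m p → Dec (IsPeriod w i m p)
isPeriod? w i m p = (1 ≤? p) ×-dec map′ (λ h j j+p<m → h (≤-<-trans (m≤m+n j p) j+p<m) j+p<m) (λ h {j} _ → h j)
  (allUpTo? (λ j → (j + p <? m) →-dec (w (i + j) Fin.≟ w (i + j + p))) m)

isPeriod-transfer : ∀ w i i′ m p → factorAt w i m ≡ factorAt w i′ m → IsPeriod w i m p → IsPeriod w i′ m p
isPeriod-transfer w i i′ m p eq (p≥1 , per) = p≥1 , λ j j+p<m →
  trans (sym (factorAt-agree w i i′ m eq j (≤-<-trans (m≤m+n j p) j+p<m)))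
    (trans (per j j+p<m) (trans (cong w (+-assoc i j p)) (trans (factorAt-agree w i i′ m eq (j + p) j+p<m) (cong w (sym (+-assoc i′ j p))))))

-- The tail has length `m ∸ p`, so the exponent `m / p` exceeds `1 + g / s`. The bound on `p` makes
-- the subtraction honest, in the form that `anyUpTo?` expects.
HasRepetition : Word → ℕ → ℕ → ℕ → ℕ → Set
HasRepetition w g s m i = ∃ λ p → p < suc m × IsPeriod w i m p × g * p < s * (m ∸ p)

-- Only finitely many factors have to be inspected, and each of them comes with a position.
repetition? : ∀ w → ComplexityTwoNPlusOne w → ∀ g s N → Dec (∃ λ m → m < suc N × ∃ (HasRepetition w g s m))
repetition? w cplx g s N = anyUpTo? at-length? (suc N)
  where
  at-position? : ∀ m i → Dec (HasRepetition w g s m i)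
  at-position? m i = anyUpTo? (λ p → isPeriod? w i m p ×-dec (g * p <? s * (m ∸ p))) (suc m)
  at-length? : ∀ m → Dec (∃ (HasRepetition w g s m))
  at-length? m with cplx m
  ... | L , _ , _ , iff with any? (at-position? m) (mapWith∈ L (λ {u} u∈L → proj₁ (Equivalence.to (iff u) u∈L)))
  ... | yes found = yes (let i , _ , rep = find found in i , rep)
  ... | no none = no λ { (i , p , p≤m , per , ineq) →
    let u∈L = Equivalence.from (iff (factorAt w i m)) (i , refl)
        i′ , eq = Equivalence.to (iff (factorAt w i m)) u∈L
    in none (mapWith∈⁺ _ (factorAt w i m , u∈L , p , p≤m , isPeriod-transfer w i i′ m p (sym eq) per , ineq)) }

-- The passage from refutation to existence: the decision is made first, and its negative outcome is
-- the avoidance on which the language of recurrent words rests.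
∃-repetition : ∀ w → ComplexityTwoNPlusOne w → ∀ g s N → 2 * g < 3 * s → 100 ≤ N →
  (∀ x y z → x ≤ 8 → y ≤ 8 → z ≤ 8 → ∃ λ k → 9 * 4 ^ k * 100 ≤ N
    × α k (suc x) (suc y) (suc z) + τ k (suc x) (suc y) (suc z) ≤ N
    × g * α k (suc x) (suc y) (suc z) < s * τ k (suc x) (suc y) (suc z)) →
  ∃ λ m → ∃ (HasRepetition w g s m)
∃-repetition w cplx g s N 2g<3s 100≤N beaten with repetition? w cplx g s N
... | yes (m , _ , found) = m , found
... | no none = ⊥-elim (no-language 100≤N beaten Recurrent (recurrent-language (Rep g s N) avoids) (recurrent-counted cplx)
    (λ i k → k (i , ≤-refl , tt)))
  where
  open Recurrence w
  open Derived g s N 2g<3s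
  avoids : ∀ i p t → Rep g s N p t → ¬ (∀ n → n < t → w (i + n) ≡ w (i + p + n))
  avoids i p t (p≥1 , len , ineq) per = none (p + t , s≤s len , i , p , s≤s (m≤m+n p t) ,
    (p≥1 , λ j j+p< → trans (per j (+-cancelˡ-< p j t (subst (_< p + t) (+-comm j p) j+p<)))
       (cong w (trans (+-assoc i p j) (trans (cong (i +_) (+-comm p j)) (sym (+-assoc i j p)))))) ,
    subst (λ n → g * p < s * n) (sym (m+n∸m≡n p t)) ineq)

-- From rational cuts to inequalities of natural numbers

integer : ℕ → ℚᵘ
integer n = mkℚᵘ (ℤ.+ n) 0

toℚᵘ-ℕ : ∀ n → toℚᵘ (ℕtoℚ n) ≃ integer n
toℚᵘ-ℕ n = ℚ.toℚᵘ-fromℚᵘ (integer n)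

ℕtoℚ-+ : ∀ x y → ℕtoℚ (x + y) ≡ ℕtoℚ x ℚ.+ ℕtoℚ y
ℕtoℚ-+ x y = ℚ.toℚᵘ-injective (begin
  toℚᵘ (ℕtoℚ (x + y))              ≈⟨ toℚᵘ-ℕ (x + y) ⟩
  integer (x + y)                  ≈⟨ *≡* (cong (ℤ._* ℤ.+ 1) (sym (cong₂ ℤ._+_ (ℤ.*-identityʳ (ℤ.+ x)) (ℤ.*-identityʳ (ℤ.+ y))))) ⟩
  integer x ℚᵘ.+ integer y           ≈⟨ ℚᵘ.+-cong (toℚᵘ-ℕ x) (toℚᵘ-ℕ y) ⟨
  toℚᵘ (ℕtoℚ x) ℚᵘ.+ toℚᵘ (ℕtoℚ y)   ≈⟨ ℚ.toℚᵘ-homo-+ (ℕtoℚ x) (ℕtoℚ y) ⟨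
  toℚᵘ (ℕtoℚ x ℚ.+ ℕtoℚ y)             ∎)
  where open import Relation.Binary.Reasoning.Setoid ℚᵘ.≃-setoid

ℕtoℚ-* : ∀ x y → ℕtoℚ (x * y) ≡ ℕtoℚ x ℚ.* ℕtoℚ y
ℕtoℚ-* x y = ℚ.toℚᵘ-injective (begin
  toℚᵘ (ℕtoℚ (x * y))              ≈⟨ toℚᵘ-ℕ (x * y) ⟩
  integer (x * y)                  ≈⟨ *≡* (cong (ℤ._* ℤ.+ 1) (ℤ.pos-* x y)) ⟩
  integer x ℚᵘ.* integer y           ≈⟨ ℚᵘ.*-cong (toℚᵘ-ℕ x) (toℚᵘ-ℕ y) ⟨
  toℚᵘ (ℕtoℚ x) ℚᵘ.* toℚᵘ (ℕtoℚ y)   ≈⟨ ℚ.toℚᵘ-homo-* (ℕtoℚ x) (ℕtoℚ y) ⟨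
  toℚᵘ (ℕtoℚ x ℚ.* ℕtoℚ y)             ∎)
  where open import Relation.Binary.Reasoning.Setoid ℚᵘ.≃-setoid

ℕtoℚ-*₃ : ∀ x y z → ℕtoℚ (x * y * z) ≡ ℕtoℚ x ℚ.* ℕtoℚ y ℚ.* ℕtoℚ z
ℕtoℚ-*₃ x y z = trans (ℕtoℚ-* (x * y) z) (cong (ℚ._* ℕtoℚ z) (ℕtoℚ-* x y))

ℕtoℚ-mono-< : ∀ x y → x < y → ℕtoℚ x ℚ.< ℕtoℚ y
ℕtoℚ-mono-< x y x<y = ℚ.toℚᵘ-cancel-< (ℚᵘ.<-respˡ-≃ (ℚᵘ.≃-sym (toℚᵘ-ℕ x)) (ℚᵘ.<-respʳ-≃ (ℚᵘ.≃-sym (toℚᵘ-ℕ y))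
  (*<* (subst₂ ℤ._<_ (sym (ℤ.*-identityʳ (ℤ.+ x))) (sym (ℤ.*-identityʳ (ℤ.+ y))) (ℤ.+<+ x<y)))))

ℕtoℚ-cancel-< : ∀ x y → ℕtoℚ x ℚ.< ℕtoℚ y → x < y
ℕtoℚ-cancel-< x y lt with ℚᵘ.<-respˡ-≃ (toℚᵘ-ℕ x) (ℚᵘ.<-respʳ-≃ (toℚᵘ-ℕ y) (ℚ.toℚᵘ-mono-< lt))
... | *<* lt′ = ℤ.drop‿+<+ (subst₂ ℤ._<_ (ℤ.*-identityʳ (ℤ.+ x)) (ℤ.*-identityʳ (ℤ.+ y)) lt′)

fraction : ∀ p → 0ℚ ℚ.≤ p → ∃ λ n → ∃ λ d → p ℚ.* ℕtoℚ (suc d) ≡ ℕtoℚ n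
fraction p@(mkℚ (ℤ.+ n) d _) _ = n , d , ℚ.toℚᵘ-injective (begin
  toℚᵘ (p ℚ.* ℕtoℚ (suc d))               ≈⟨ ℚ.toℚᵘ-homo-* p (ℕtoℚ (suc d)) ⟩
  toℚᵘ p ℚᵘ.* toℚᵘ (ℕtoℚ (suc d))       ≈⟨ ℚᵘ.*-cong {toℚᵘ p} ℚᵘ.≃-refl (toℚᵘ-ℕ (suc d)) ⟩
  toℚᵘ p ℚᵘ.* integer (suc d)           ≈⟨ *≡* (trans (ℤ.*-identityʳ _) (cong (λ k → ℤ.+ n ℤ.* ℤ.+ k) (sym (*-identityʳ (suc d))))) ⟩
  integer n                             ≈⟨ toℚᵘ-ℕ n ⟨
  toℚᵘ (ℕtoℚ n)                         ∎)
  where open import Relation.Binary.Reasoning.Setoid ℚᵘ.≃-setoid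
fraction (mkℚ ℤ.-[1+ _ ] _ _) (*≤* ())

0<difference : ∀ {x y} → 0ℚ ℚ.< y ℚ.- x → x ℚ.< y
0<difference {x} {y} lt = subst₂ ℚ._<_ (ℚ.+-identityˡ x) (cancel y x) (ℚ.+-monoˡ-< x lt)
  where
  cancel : ∀ y x → y ℚ.- x ℚ.+ x ≡ y
  cancel = +-*-Solver.solve 2 (λ y x → y :- x :+ x := y) refl
    where open +-*-Solver

-- Multiply `fλ c` by the cube of the denominator and move the negative terms to the other side.
λBelow-ℕ : ∀ c m d → c ℚ.* ℕtoℚ (suc d) ≡ ℕtoℚ m → λBelow c →
  suc d * suc d * suc d + 2 * m * m * suc d < m * m * m + m * suc d * suc d
λBelow-ℕ c m d cD≡M 0<f = ℕtoℚ-cancel-< _ (m * m * m + m * suc d * suc d) (subst₂ ℚ._<_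
  (sym (trans (ℕtoℚ-+ (d′ * d′ * d′) _) (cong₂ ℚ._+_ (ℕtoℚ-*₃ d′ d′ d′) (trans (ℕtoℚ-* (2 * m * m) d′) (cong (ℚ._* D) (ℕtoℚ-*₃ 2 m m))))))
  (sym (trans (ℕtoℚ-+ (m * m * m) _) (cong₂ ℚ._+_ (ℕtoℚ-*₃ m m m) (ℕtoℚ-*₃ m d′ d′))))
  (0<difference (subst₂ ℚ._<_ (ℚ.*-zeroˡ (D ℚ.* D ℚ.* D)) scale (ℚ.*-monoˡ-<-pos (D ℚ.* D ℚ.* D) {{pos₃}} 0<f))))
  where
  d′ = suc d
  D = ℕtoℚ d′
  M = ℕtoℚ m
  pos₃ = ℚ.positive (subst (0ℚ ℚ.<_) (ℕtoℚ-*₃ d′ d′ d′) (ℕtoℚ-mono-< 0 (d′ * d′ * d′) (s≤s z≤n)))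
  expand : ∀ c D t → (c ℚ.* c ℚ.* c ℚ.- t ℚ.* c ℚ.* c ℚ.+ c ℚ.- 1ℚ) ℚ.* (D ℚ.* D ℚ.* D)
         ≡ (c ℚ.* D ℚ.* (c ℚ.* D) ℚ.* (c ℚ.* D) ℚ.+ c ℚ.* D ℚ.* D ℚ.* D) ℚ.- (D ℚ.* D ℚ.* D ℚ.+ t ℚ.* (c ℚ.* D) ℚ.* (c ℚ.* D) ℚ.* D)
  expand = +-*-Solver.solve 3 (λ c D t → (c :* c :* c :- t :* c :* c :+ c :- con 1ℚ) :* (D :* D :* D)
         := (c :* D :* (c :* D) :* (c :* D) :+ c :* D :* D :* D) :- (D :* D :* D :+ t :* (c :* D) :* (c :* D) :* D)) refl
    where open +-*-Solver
  scale : fλ c ℚ.* (D ℚ.* D ℚ.* D) ≡ (M ℚ.* M ℚ.* M ℚ.+ M ℚ.* D ℚ.* D) ℚ.- (D ℚ.* D ℚ.* D ℚ.+ ℕtoℚ 2 ℚ.* M ℚ.* M ℚ.* D)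
  scale = trans (expand c D (ℕtoℚ 2))
    (cong (λ x → (x ℚ.* x ℚ.* x ℚ.+ x ℚ.* D ℚ.* D) ℚ.- (D ℚ.* D ℚ.* D ℚ.+ ℕtoℚ 2 ℚ.* x ℚ.* x ℚ.* D)) cD≡M)

product-below-ℕ : ∀ c u m d r s → c ℚ.* ℕtoℚ (suc d) ≡ ℕtoℚ m → u ℚ.* ℕtoℚ (suc s) ≡ ℕtoℚ r → (c ℚ.* c ℚ.- 1ℚ) ℚ.* u ℚ.< 1ℚ →
  m * m * r < suc d * suc d * (r + suc s)
product-below-ℕ c u m d r s cD≡M uS≡R lt = ℕtoℚ-cancel-< (m * m * r) (suc d * suc d * (r + suc s)) (subst₂ ℚ._<_
  (sym (ℕtoℚ-*₃ m m r))
  (sym (trans (ℕtoℚ-* (d′ * d′) (r + s′)) (cong₂ ℚ._*_ (ℕtoℚ-* d′ d′) (ℕtoℚ-+ r s′))))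
  (subst₂ ℚ._<_ eqˡ eqʳ (ℚ.+-monoˡ-< (D ℚ.* D ℚ.* R) (ℚ.*-monoˡ-<-pos (D ℚ.* D ℚ.* S) {{pos₃}} lt))))
  where
  d′ = suc d
  s′ = suc s
  D = ℕtoℚ d′
  M = ℕtoℚ m
  R = ℕtoℚ r
  S = ℕtoℚ s′
  pos₃ = ℚ.positive (subst (0ℚ ℚ.<_) (ℕtoℚ-*₃ d′ d′ s′) (ℕtoℚ-mono-< 0 (d′ * d′ * s′) (s≤s z≤n)))
  expand : ∀ c u D S → (c ℚ.* c ℚ.- 1ℚ) ℚ.* u ℚ.* (D ℚ.* D ℚ.* S) ℚ.+ D ℚ.* D ℚ.* (u ℚ.* S) ≡ c ℚ.* D ℚ.* (c ℚ.* D) ℚ.* (u ℚ.* S)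
  expand = +-*-Solver.solve 4 (λ c u D S → (c :* c :- con 1ℚ) :* u :* (D :* D :* S) :+ D :* D :* (u :* S)
         := c :* D :* (c :* D) :* (u :* S)) refl
    where open +-*-Solver
  eqˡ : (c ℚ.* c ℚ.- 1ℚ) ℚ.* u ℚ.* (D ℚ.* D ℚ.* S) ℚ.+ D ℚ.* D ℚ.* R ≡ M ℚ.* M ℚ.* R
  eqˡ = trans (cong (λ x → (c ℚ.* c ℚ.- 1ℚ) ℚ.* u ℚ.* (D ℚ.* D ℚ.* S) ℚ.+ D ℚ.* D ℚ.* x) (sym uS≡R))
    (trans (expand c u D S) (cong₂ (λ x y → x ℚ.* x ℚ.* y) cD≡M uS≡R))
  eqʳ : 1ℚ ℚ.* (D ℚ.* D ℚ.* S) ℚ.+ D ℚ.* D ℚ.* R ≡ D ℚ.* D ℚ.* (R ℚ.+ S)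
  eqʳ = +-*-Solver.solve 3 (λ D R S → con 1ℚ :* (D :* D :* S) :+ D :* D :* R := D :* D :* (R :+ S)) refl D R S
    where open +-*-Solver

-- c³ - 2c² + c - 1 = c (c - 1)² - 1
cubic-shift : ∀ m d → d * d * d + 2 * m * m * d < m * m * m + m * d * d →
  ∃ λ e → m ≡ d + e × d * d * d < (d + e) * e * e
cubic-shift m d cubic = m ∸ d , m≡ , +-cancelʳ-< (2 * (d + e) * (d + e) * d) _ _ (begin-strict
  d * d * d + 2 * (d + e) * (d + e) * d               ≡⟨ cong (λ m → d * d * d + 2 * m * m * d) m≡ ⟨
  d * d * d + 2 * m * m * d                           <⟨ cubic ⟩
  m * m * m + m * d * d                               ≡⟨ cong (λ m → m * m * m + m * d * d) m≡ ⟩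
  (d + e) * (d + e) * (d + e) + (d + e) * d * d       ≡⟨ eq₂ d e ⟩
  (d + e) * e * e + 2 * (d + e) * (d + e) * d         ∎)
  where
  open ≤-Reasoning
  e = m ∸ d
  eq₁ : ∀ m d → m * m * d + d * d * d + m * m * d ≡ d * d * d + 2 * m * m * d
  eq₁ = solve-∀
  eq₂ : ∀ d e → (d + e) * (d + e) * (d + e) + (d + e) * d * d ≡ (d + e) * e * e + 2 * (d + e) * (d + e) * d
  eq₂ = solve-∀
  d≤m : d ≤ m
  d≤m = ≮⇒≥ λ m<d → <⇒≱ cubic (begin
    m * m * m + m * d * d              ≤⟨ +-mono-≤ (*-monoʳ-≤ (m * m) (<⇒≤ m<d)) (*-monoˡ-≤ d (*-monoˡ-≤ d (<⇒≤ m<d))) ⟩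
    m * m * d + d * d * d              ≤⟨ m≤m+n _ (m * m * d) ⟩
    m * m * d + d * d * d + m * m * d  ≡⟨ eq₁ m d ⟩
    d * d * d + 2 * m * m * d          ∎)
  m≡ : m ≡ d + e
  m≡ = sym (m+[n∸m]≡n d≤m)

-- At c = 7/4 the product c (c - 1)² is 63/64, so 7/4 lies below λ.
3d≤4e : ∀ d e → d * d * d < (d + e) * e * e → 3 * d ≤ 4 * e
3d≤4e d e lt = ≮⇒≥ λ 4e<3d → <⇒≱ lt (*-cancelˡ-≤ 64 (begin
  64 * ((d + e) * e * e)                         ≡⟨ eq₁ d e ⟩
  (4 * d + 4 * e) * (4 * e) * (4 * e)      ≤⟨ *-mono-≤ (*-mono-≤ (+-monoʳ-≤ (4 * d) (<⇒≤ 4e<3d)) (<⇒≤ 4e<3d)) (<⇒≤ 4e<3d) ⟩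
  (4 * d + 3 * d) * (3 * d) * (3 * d)      ≡⟨ eq₂ d ⟩
  63 * (d * d * d)                                 ≤⟨ *-monoˡ-≤ (d * d * d) (n≤1+n 63) ⟩
  64 * (d * d * d)                                 ∎))
  where
  open ≤-Reasoning
  eq₁ : ∀ d e → 64 * ((d + e) * e * e) ≡ (4 * d + 4 * e) * (4 * e) * (4 * e)
  eq₁ = solve-∀
  eq₂ : ∀ d → (4 * d + 3 * d) * (3 * d) * (3 * d) ≡ 63 * (d * d * d)
  eq₂ = solve-∀

-- As (7/4)² = 49/16 > 3, the last hypothesis gives `3 * r < r + s`. This keeps the exponent
-- `2 + r / s` below 5/2.
2r<s : ∀ d e r s → 1 ≤ d → 3 * d ≤ 4 * e → (d + e) * (d + e) * r < d * d * (r + s) → 2 * r < s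
2r<s d e r s d≥1 3d≤4e lt = +-cancelˡ-< r _ _ (*-cancelˡ-< (16 * (d * d)) _ _ (begin-strict
  16 * (d * d) * (r + 2 * r)                     ≡⟨ eq₁ d r ⟩
  48 * (d * d) * r                                   ≤⟨ *-monoˡ-≤ r (*-monoˡ-≤ (d * d) (n≤1+n 48)) ⟩
  49 * (d * d) * r                                   ≡⟨ eq₂ d r ⟩
  (4 * d + 3 * d) * (4 * d + 3 * d) * r    ≤⟨ *-monoˡ-≤ r (*-mono-≤ (+-monoʳ-≤ (4 * d) 3d≤4e) (+-monoʳ-≤ (4 * d) 3d≤4e)) ⟩
  (4 * d + 4 * e) * (4 * d + 4 * e) * r    ≡⟨ eq₃ d e r ⟩
  16 * ((d + e) * (d + e) * r)                   <⟨ *-monoʳ-< 16 lt ⟩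
  16 * (d * d * (r + s))                           ≡⟨ *-assoc 16 (d * d) _ ⟨
  16 * (d * d) * (r + s)                           ∎))
  where
  open ≤-Reasoning
  eq₁ : ∀ d r → 16 * (d * d) * (r + 2 * r) ≡ 48 * (d * d) * r
  eq₁ = solve-∀
  eq₂ : ∀ d r → 49 * (d * d) * r ≡ (4 * d + 3 * d) * (4 * d + 3 * d) * r
  eq₂ = solve-∀
  eq₃ : ∀ d e r → (4 * d + 4 * e) * (4 * d + 4 * e) * r ≡ 16 * ((d + e) * (d + e) * r)
  eq₃ = solve-∀

-- The repetition above a given exponent

sumTo : (ℕ → ℕ) → ℕ → ℕ
sumTo f zero = f 0
sumTo f (suc n) = sumTo f n + f (suc n)

≤-sumTo : ∀ f n i → i ≤ n → f i ≤ sumTo f n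
≤-sumTo f zero zero _ = ≤-refl
≤-sumTo f (suc n) i i≤ with i ≟ suc n
... | yes refl = m≤n+m _ _
... | no i≢ = ≤-trans (≤-sumTo f n i (≤-pred (≤∧≢⇒< i≤ i≢))) (m≤m+n _ _)

∃-long-repetition : ∀ w → ComplexityTwoNPlusOne w → ∀ d e r s → 1 ≤ d → 1 ≤ r → 1 ≤ s →
  d * d * d < (d + e) * e * e → (d + e) * (d + e) * r < d * d * (r + s) →
  ∃ λ m → ∃ (HasRepetition w (r + s) s m)
∃-long-repetition w cplx d e r s d≥1 r≥1 s≥1 cubic below =
  ∃-repetition w cplx g s N 2g<3s (m≤m+n 100 _) λ x y z x≤8 y≤8 z≤8 →
    let k , long = beats x y z
        need≤N = ≤-trans (≤-sumTo (need x y) 8 z z≤8) (≤-trans (≤-sumTo (λ y → sumTo (need x y) 8) 8 y y≤8)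
          (≤-trans (≤-sumTo (λ x → sumTo (λ y → sumTo (need x y) 8) 8) 8 x x≤8) (m≤n+m _ 100)))
    in k , ≤-trans (m≤m+n _ _) need≤N , ≤-trans (m≤n+m _ (9 * 4 ^ k * 100)) need≤N , long
  where
  g = r + s
  open Growth d e ((d + e) * e * e ∸ d * d * d) r s d≥1 (m<n⇒0<n∸m cubic) r≥1 s≥1
    (m∸n+n≡m (<⇒≤ cubic)) (<⇒≤ below) using (exceeds)
  beats : ∀ x y z → ∃ λ k → g * α k (suc x) (suc y) (suc z) < s * τ k (suc x) (suc y) (suc z)
  beats x y z = exceeds (suc x) (suc y) (suc z) (s≤s z≤n)
  need : ℕ → ℕ → ℕ → ℕ
  need x y z = let k = proj₁ (beats x y z) in
    9 * 4 ^ k * 100 + (α k (suc x) (suc y) (suc z) + τ k (suc x) (suc y) (suc z))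
  -- One bound for all triples of weights, since the triple at the leaf is not known in advance; a
  -- sum serves as well as a maximum.
  N = 100 + sumTo (λ x → sumTo (λ y → sumTo (need x y) 8) 8) 8
  2g<3s : 2 * g < 3 * s
  2g<3s = ≤-trans (≤-reflexive (cong suc (eq₁ r s))) (≤-trans (+-monoˡ-< (2 * s) (2r<s d e r s d≥1 (3d≤4e d e cubic) below)) (≤-reflexive (eq₂ s)))
    where
    eq₁ : ∀ r s → 2 * (r + s) ≡ 2 * r + 2 * s
    eq₁ = solve-∀
    eq₂ : ∀ s → s + 2 * s ≡ 3 * s
    eq₂ = solve-∀

-- With `g = r + s`, the condition on `m ∸ p` becomes `m / p > 2 + r / s`, which is at least q. The
-- period `p` need not be the smallest, but a smaller one only raises the exponent.
exponent : ∀ w q r s → q ℚ.* ℕtoℚ (suc s) ℚ.≤ ℕtoℚ (r + 2 * suc s) →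
  (∃ λ m → ∃ (HasRepetition w (r + suc s) (suc s) m)) → HasFactorWithExponentAbove w q
exponent w q r s qS≤ (m , i , p , s≤s p≤m , per , gp<st) with least (isPeriod? w i m) p p ≤-refl per
... | p₀ , p₀≤p , per₀ , min = i , m , p₀ , ≤-trans (proj₁ per) p≤m , (per₀ , min) ,
  ℚ.*-cancelʳ-<-nonNeg S {{ℚ.nonNegative (ℚ.<⇒≤ 0<S)}} (begin-strict
    q ℚ.* ℕtoℚ p₀ ℚ.* S             ≡⟨ swap q (ℕtoℚ p₀) S ⟩
    q ℚ.* S ℚ.* ℕtoℚ p₀             ≤⟨ ℚ.*-monoʳ-≤-nonNeg (ℕtoℚ p₀) {{ℚ.nonNegative 0≤p₀}} qS≤ ⟩
    ℕtoℚ (r + 2 * s′) ℚ.* ℕtoℚ p₀ ≡⟨ ℕtoℚ-* (r + 2 * s′) p₀ ⟨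
    ℕtoℚ ((r + 2 * s′) * p₀)  <⟨ ℕtoℚ-mono-< _ (m * s′) nat ⟩
    ℕtoℚ (m * s′)             ≡⟨ ℕtoℚ-* m s′ ⟩
    ℕtoℚ m ℚ.* S                  ∎)
  where
  open ℚ.≤-Reasoning
  s′ = suc s
  S = ℕtoℚ s′
  0<S : 0ℚ ℚ.< S
  0<S = ℕtoℚ-mono-< 0 (suc s) (s≤s z≤n)
  0≤p₀ : 0ℚ ℚ.≤ ℕtoℚ p₀
  0≤p₀ = ℚ.<⇒≤ (ℕtoℚ-mono-< 0 p₀ (proj₁ per₀))
  swap : ∀ x y z → x ℚ.* y ℚ.* z ≡ x ℚ.* z ℚ.* y
  swap = +-*-Solver.solve 3 (λ x y z → x :* y :* z := x :* z :* y) refl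
    where open +-*-Solver
  nat : (r + 2 * s′) * p₀ < m * s′
  nat = ℕR.begin-strict
    (r + 2 * s′) * p₀              ℕR.≤⟨ *-monoʳ-≤ (r + 2 * s′) p₀≤p ⟩
    (r + 2 * s′) * p               ℕR.≡⟨ eq₁ r s′ p ⟩
    s′ * p + (r + s′) * p        ℕR.<⟨ +-monoʳ-< (s′ * p) gp<st ⟩
    s′ * p + s′ * (m ∸ p)        ℕR.≡⟨ *-distribˡ-+ s′ p (m ∸ p) ⟨
    s′ * (p + (m ∸ p))             ℕR.≡⟨ cong (s′ *_) (m+[n∸m]≡n p≤m) ⟩
    s′ * m                             ℕR.≡⟨ *-comm s′ m ⟩
    m * s′                             ℕR.∎
    where
    module ℕR = ≤-Reasoning
    eq₁ : ∀ r s p → (r + 2 * s) * p ≡ s * p + (r + s) * p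
    eq₁ = solve-∀

exponent-above-2 : ∀ w → ComplexityTwoNPlusOne w → ∀ q c m d r s → 0ℚ ℚ.< q ℚ.- ℕtoℚ 2 → λBelow c →
  (c ℚ.* c ℚ.- 1ℚ) ℚ.* (q ℚ.- ℕtoℚ 2) ℚ.< 1ℚ →
  c ℚ.* ℕtoℚ (suc d) ≡ ℕtoℚ m → (q ℚ.- ℕtoℚ 2) ℚ.* ℕtoℚ (suc s) ≡ ℕtoℚ r → HasFactorWithExponentAbove w q
exponent-above-2 w cplx q c m d r s 0<q-2 0<f below cD≡M uS≡R =
  let e , m≡ , cubic = cubic-shift m (suc d) (λBelow-ℕ c m d cD≡M 0<f)
  in exponent w q r s (ℚ.≤-reflexive qS≡) (∃-long-repetition w cplx (suc d) e r (suc s) (s≤s z≤n) r≥1 (s≤s z≤n) cubic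
    (subst (λ m → m * m * r < suc d * suc d * (r + suc s)) m≡ (product-below-ℕ c (q ℚ.- ℕtoℚ 2) m d r s cD≡M uS≡R below)))
  where
  S = ℕtoℚ (suc s)
  0<S : 0ℚ ℚ.< S
  0<S = ℕtoℚ-mono-< 0 (suc s) (s≤s z≤n)
  r≥1 : 1 ≤ r
  r≥1 = ℕtoℚ-cancel-< 0 r (subst₂ ℚ._<_ (ℚ.*-zeroˡ S) uS≡R (ℚ.*-monoˡ-<-pos S {{ℚ.positive 0<S}} 0<q-2))
  split-q : ∀ q S t → q ℚ.* S ≡ (q ℚ.- t) ℚ.* S ℚ.+ t ℚ.* S
  split-q = +-*-Solver.solve 3 (λ q S t → q :* S := (q :- t) :* S :+ t :* S) refl
    where open +-*-Solver
  qS≡ : q ℚ.* S ≡ ℕtoℚ (r + 2 * suc s)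
  qS≡ = trans (split-q q S (ℕtoℚ 2)) (trans (cong₂ ℚ._+_ uS≡R (sym (ℕtoℚ-* 2 (suc s)))) (sym (ℕtoℚ-+ r _)))

mainTheorem1 : (w : Word) → ComplexityTwoNPlusOne w → CriticalExponentAtLeastMu w
-- the case c = 2 and q = 2 + 1 / 4 of the second clause already covers all q ≤ 2
mainTheorem1 w cplx q (inj₁ q≤2) = exponent w q 1 3
  (ℚ.≤-trans (ℚ.*-monoʳ-≤-nonNeg (ℕtoℚ 4) q≤2) (ℚ.<⇒≤ (subst (ℚ._< ℕtoℚ 9) (ℕtoℚ-* 2 4) (ℕtoℚ-mono-< 8 9 (n<1+n 8)))))
  (∃-long-repetition w cplx 1 1 1 4 (s≤s z≤n) (s≤s z≤n) (s≤s z≤n) (n<1+n 1) (n<1+n 4))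
mainTheorem1 w cplx q (inj₂ (2<q , c , 0≤c , 0<f , below)) =
  let m , d , cD≡M = fraction c 0≤c
      r , s , uS≡R = fraction (q ℚ.- ℕtoℚ 2) (ℚ.<⇒≤ 0<q-2)
  in exponent-above-2 w cplx q c m d r s 0<q-2 0<f below cD≡M uS≡R
  where
  0<q-2 : 0ℚ ℚ.< q ℚ.- ℕtoℚ 2
  0<q-2 = subst (ℚ._< q ℚ.- ℕtoℚ 2) (ℚ.+-inverseʳ (ℕtoℚ 2)) (ℚ.+-monoˡ-< (ℚ.- ℕtoℚ 2) 2<q)
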